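{- There is an absolute constant $C$ such that the following holds. Let $f:\{0,1\}^n\to\{0,1\}$ be a balanced boolean function chosen uniformly at random among all balanced boolean functions. Then, with probability tending to $1$ as $n\to\infty$, there exists a mapping $\phi:\{0,1\}^n\to\{0,1\}^n$ from $\mathrm{Dictator}$ to $f$ such that $\mathrm{dist}(x,\phi(x))\le C$ for all $x\in\{0,1\}^n$. In particular, such $\phi$ is $(2C+1)$-bi-Lipschitz.
   Context: $\mathrm{dist}$ is Hamming distance on $\{0,1\}^n$. $\mathrm{Dictator}(x)=x_1$. A boolean function $g$ is balanced if $|g^{ -1}(0)|=|g^{ -1}(1)|$. A mapping from $f$ to $g$ is a bijection $\phi$ of $\{0,1\}^n$ with $f(x)=g(\phi(x))$ for all $x$. A bijection $\phi$ is $C'$-bi-Lipschitz if both $\phi$ and $\phi^{ -1}$ satisfy $\mathrm{dist}(\psi(x),\psi(y))\le C'\mathrm{dist}(x,y)$ for all $x,y$. -}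

module Defs where

open import Data.Bool using (Bool; true; false; if_then_else_; _≟_)
open import Data.Nat using (ℕ; zero; suc; _+_; _*_; _≤_)
open import Data.Vec using (Vec; []; _∷_; head)
open import Data.List using (List; []; _∷_; _++_; map; concatMap; filter; length)
open import Data.List.Relation.Binary.Sublist.Propositional using (_⊆_)
open import Data.List.Relation.Unary.All using (All)
open import Data.Product using (Σ; ∃; _×_; _,_)
open import Function.Bundles using (_↔_; Inverse)
open import Relation.Binary.PropositionalEquality using (_≡_)
open import Relation.Nullary using (Dec; yes; no)

Cube : ℕ → Set
Cube n = Vec Bool n

dist : ∀ {n} → Cube n → Cube n → ℕ
dist [] [] = 0
dist (a ∷ x) (b ∷ y) = (if does (a ≟ b) then 0 else 1) + dist x y
  where open import Relation.Nullary using (does)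

Dictator : ∀ {n} → Cube (suc n) → Bool
Dictator x = head x

allCube : (n : ℕ) → List (Cube n)
allCube zero = [] ∷ []
allCube (suc n) = map (false ∷_) (allCube n) ++ map (true ∷_) (allCube n)

-- Enumeration of all boolean functions on the cube (each function,
-- up to pointwise equality, appears exactly once)
allFun : (n : ℕ) → List (Cube n → Bool)
allFun zero = (λ _ → false) ∷ (λ _ → true) ∷ []
allFun (suc n) =
  concatMap (λ h → map (λ g → λ { (b ∷ x) → if b then g x else h x }) (allFun n)) (allFun n)

countVal : ∀ {n} → (Cube n → Bool) → Bool → ℕ
countVal {n} f b = length (filter (λ x → f x ≟ b) (allCube n))

Balanced : ∀ {n} → (Cube n → Bool) → Set
Balanced f = countVal f false ≡ countVal f true

balanced? : ∀ {n} (f : Cube n → Bool) → Dec (Balanced f)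
balanced? f = Data.Nat._≟_ (countVal f false) (countVal f true)
  where import Data.Nat

-- the sample space: all balanced boolean functions (uniform distribution)
balancedFuns : (n : ℕ) → List (Cube n → Bool)
balancedFuns n = filter balanced? (allFun n)

IsMapping : ∀ {n} → (Cube n → Bool) → (Cube n → Bool) → (Cube n ↔ Cube n) → Set
IsMapping f g φ = ∀ x → f x ≡ g (Inverse.to φ x)

BiLipschitz : ∀ {n} → ℕ → (Cube n ↔ Cube n) → Set
BiLipschitz C' φ =
  (∀ x y → dist (Inverse.to φ x) (Inverse.to φ y) ≤ C' * dist x y) ×
  (∀ x y → dist (Inverse.from φ x) (Inverse.from φ y) ≤ C' * dist x y)

Good : ∀ {n} → ℕ → (Cube (suc n) → Bool) → Set
Good C f = Σ (Cube _ ↔ Cube _) λ φ →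
  IsMapping Dictator f φ × (∀ x → dist x (Inverse.to φ x) ≤ C) × BiLipschitz (2 * C + 1) φ

{-# OPTIONS --safe #-}
-- Let A = {x₁ = 1, f = 0} and B = {x₁ = 0, f = 1}. Balancedness gives |A| = |B|, and a bijection A → B moving
-- points by at most 12 yields an involution φ that exchanges matched points and fixes all others.
--
-- Split the remaining n coordinates into four Hamming codes of length about n/8 to n/4 and some spare coordinates.
-- Products of radius-1 balls around codewords partition the cube into blocks of bounded diameter and size of order
-- n⁴, indexed by a smaller cube so that adjacent blocks are at bounded distance. By a Chernoff bound, with high
-- probability A and B both fill each block to within a factor 1 ± O(1/n) of half of it: the failure probability
-- exp(-Ω(n²)) beats the number of blocks and the factor 2ⁿ + 1 lost in conditioning on balancedness.
-- Then the imbalances |A ∩ block| - |B ∩ block| are cancelled by an integral flow along the edges of the index cube,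
-- direction by direction; the n directions use up only part of each block, so every unit of flow can be realised
-- by matching a point of A with a point of B in an adjacent block.
module Submission where

open import Defs
open import Data.Bool using (Bool; true; false; if_then_else_; _xor_; _≟_; not)
open import Data.Bool.Properties using (xor-identityʳ)
open import Data.Empty using (⊥-elim)
open import Data.List
  using (List; []; _∷_; _++_; map; filter; length; take; drop; concatMap; cartesianProductWith; downFrom)
open import Data.List.Membership.Propositional using (_∈_)
open import Data.List.Membership.Propositional.Properties
  using (∈-++⁺ˡ; ∈-++⁺ʳ; ∈-map⁺; ∈-map⁻; ∈-filter⁺; ∈-filter⁻; ∈-cartesianProductWith⁺)
open import Data.List.Membership.Propositional.Properties.WithK using (unique∧set⇒bag)
open import Data.List.Properties
  using (length-++; length-take; length-drop; length-map; length-filter; length-downFrom; take++drop≡id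
        ; map-++; map-∘; map-cong; filter-++; concatMap-++; concatMap-map; ++-assoc; ++-identityʳ)
open import Data.List.Relation.Binary.BagAndSetEquality using (∼bag⇒↭)
open import Data.List.Relation.Binary.Permutation.Propositional
  using (_↭_; ↭-refl; ↭-reflexive; ↭-trans; ↭-sym; ↭⇒↭ₛ)
open import Data.List.Relation.Binary.Permutation.Propositional.Properties
  using (++⁺; ++⁺ˡ; shifts; ∈-resp-↭; filter-↭; ↭-length) renaming (map⁺ to ↭-map⁺)
import Data.List.Relation.Binary.Permutation.Setoid.Properties as ↭ₛ
open import Data.List.Relation.Binary.Sublist.Propositional using (_⊆_)
open import Data.List.Relation.Binary.Sublist.Propositional.Properties using (filter-⊆; length-mono-≤; filter⁺)
open import Data.List.Relation.Unary.All as All using (All; []; _∷_)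
open import Data.List.Relation.Unary.All.Properties using () renaming (++⁺ to All-++⁺)
open import Data.List.Relation.Unary.AllPairs using ([]; _∷_)
open import Data.List.Relation.Unary.Any using (here; there)
open import Data.List.Relation.Unary.Unique.Propositional using (Unique)
import Data.List.Relation.Unary.Unique.Propositional.Properties as Unique
open import Data.Nat
  using (ℕ; zero; suc; _+_; _*_; _∸_; _^_; _/_; ⌊_/2⌋; ⌈_/2⌉; _≤_; _<_; z≤n; s≤s; _≤?_; _<?_; NonZero)
open import Data.Nat.DivMod using (m/n*n≤m; m≡m%n+[m/n]*n; m%n<n)
open import Data.Nat.ListAction using (sum; product)
open import Data.Nat.ListAction.Properties using (sum-++; product-++; product-↭)
open import Data.Nat.Properties hiding (_≟_; _≤?_; _<?_)
import Data.Nat.Properties as ℕ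
open import Data.Nat.Tactic.RingSolver using (solve-∀)
open import Data.Product using (Σ; _×_; _,_; proj₁; proj₂; uncurry)
open import Data.Vec using ([]; _∷_; head; tail; replicate; zipWith)
  renaming (_++_ to _++ᵥ_; take to takeᵥ; drop to dropᵥ)
open import Data.Vec.Properties using (≡-dec; ∷-injectiveʳ; ++-injectiveˡ; ++-injectiveʳ)
  renaming (take++drop≡id to takeᵥ++dropᵥ≡id)
open import Function using (_∘_; it)
open import Function.Bundles using (mk↔ₛ′; mk⇔)
open import Relation.Binary.Definitions using (DecidableEquality)
open import Relation.Binary.PropositionalEquality
open import Relation.Nullary using (¬_; Dec; yes; no; does; ¬?)
open import Relation.Unary using (Decidable)

-- Hamming distance and perfect codes

-- Two demands dictate the size of a block. Let a block have `2h` points and let the tolerated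
-- deviation from `h` be `M`, scaled as `h = 2q²s` and `M = 2qs`. Routing the flow through up to `n`
-- directions takes of order `n * M` points from every block, so `q` must exceed a multiple of `n`.
-- The failure probability of one block is at most `2⁻ˢ`, and the union bound together with the
-- conditioning asks for `s` above `3n`. Hence `h` has to exceed a large constant times n³, while a
-- perfect code of radius 1 only offers blocks of linear size. A product of perfect codes on
-- disjoint sets of coordinates supplies the missing power: each factor is linear in `n`, and four
-- of them beat any constant times n³ for large `n`; the surplus goes into `s`.
--
-- The constant 12 is 4 + 3 + 4 + 1: the radius of a product of four balls, the distance of adjacent
-- centres, the radius again, and the coordinate x₁, in which matched points always differ.

δ : Bool → Bool → ℕ
δ a b = if does (a ≟ b) then 0 else 1

dist-refl : ∀ {n} (x : Cube n) → dist x x ≡ 0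
dist-refl [] = refl
dist-refl (true ∷ x) = dist-refl x
dist-refl (false ∷ x) = dist-refl x

dist-sym : ∀ {n} (x y : Cube n) → dist x y ≡ dist y x
dist-sym [] [] = refl
dist-sym (a ∷ x) (b ∷ y) = cong₂ _+_ (δ-sym a b) (dist-sym x y)
  where
  δ-sym : ∀ a b → δ a b ≡ δ b a
  δ-sym true true = refl
  δ-sym true false = refl
  δ-sym false true = refl
  δ-sym false false = refl

+-interchange : ∀ a b c d → (a + b) + (c + d) ≡ (a + c) + (b + d)
+-interchange = solve-∀

dist-triangle : ∀ {n} (x y z : Cube n) → dist x z ≤ dist x y + dist y z
dist-triangle [] [] [] = z≤n
dist-triangle (a ∷ x) (b ∷ y) (c ∷ z) =
  ≤-trans (+-mono-≤ (δ-triangle a b c) (dist-triangle x y z))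
          (≤-reflexive (+-interchange (δ a b) (δ b c) (dist x y) (dist y z)))
  where
  δ-triangle : ∀ a b c → δ a c ≤ δ a b + δ b c
  δ-triangle true true true = z≤n
  δ-triangle true true false = s≤s z≤n
  δ-triangle true false true = z≤n
  δ-triangle true false false = s≤s z≤n
  δ-triangle false true true = s≤s z≤n
  δ-triangle false true false = z≤n
  δ-triangle false false true = s≤s z≤n
  δ-triangle false false false = z≤n

dist≡0⇒≡ : ∀ {n} (x y : Cube n) → dist x y ≡ 0 → x ≡ y
dist≡0⇒≡ [] [] _ = refl
dist≡0⇒≡ (true ∷ x) (true ∷ y) p = cong (true ∷_) (dist≡0⇒≡ x y p)
dist≡0⇒≡ (false ∷ x) (false ∷ y) p = cong (false ∷_) (dist≡0⇒≡ x y p)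
dist≡0⇒≡ (true ∷ x) (false ∷ y) ()
dist≡0⇒≡ (false ∷ x) (true ∷ y) ()

dist-++ : ∀ {m n} (x x′ : Cube m) (y y′ : Cube n) →
  dist (x ++ᵥ y) (x′ ++ᵥ y′) ≡ dist x x′ + dist y y′
dist-++ [] [] y y′ = refl
dist-++ (a ∷ x) (b ∷ x′) y y′ =
  trans (cong (δ a b +_) (dist-++ x x′ y y′)) (sym (+-assoc (δ a b) _ _))

take-++ : ∀ {m n} (x : Cube m) (y : Cube n) → takeᵥ m (x ++ᵥ y) ≡ x
take-++ {m} x y = ++-injectiveˡ _ x (takeᵥ++dropᵥ≡id m (x ++ᵥ y))

drop-++ : ∀ {m n} (x : Cube m) (y : Cube n) → dropᵥ m (x ++ᵥ y) ≡ y
drop-++ {m} x y = ++-injectiveʳ _ x (takeᵥ++dropᵥ≡id m (x ++ᵥ y))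

infixl 6 _⊕_
_⊕_ : ∀ {n} → Cube n → Cube n → Cube n
_⊕_ = zipWith _xor_

xor-cancelˡ : ∀ a b → (a xor b) xor a ≡ b
xor-cancelˡ true true = refl
xor-cancelˡ true false = refl
xor-cancelˡ false true = refl
xor-cancelˡ false false = refl

xor-cancelʳ : ∀ a b → (a xor b) xor b ≡ a
xor-cancelʳ true true = refl
xor-cancelʳ true false = refl
xor-cancelʳ false true = refl
xor-cancelʳ false false = refl

⊕-cancelˡ : ∀ {n} (x y : Cube n) → (x ⊕ y) ⊕ x ≡ y
⊕-cancelˡ [] [] = refl
⊕-cancelˡ (a ∷ x) (b ∷ y) = cong₂ _∷_ (xor-cancelˡ a b) (⊕-cancelˡ x y)

⊕-cancelʳ : ∀ {n} (x y : Cube n) → (x ⊕ y) ⊕ y ≡ x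
⊕-cancelʳ [] [] = refl
⊕-cancelʳ (a ∷ x) (b ∷ y) = cong₂ _∷_ (xor-cancelʳ a b) (⊕-cancelʳ x y)

δ-xor : ∀ a b c d → δ (a xor c) (b xor d) ≤ δ a b + δ c d
δ-xor true true true true = z≤n
δ-xor true true true false = s≤s z≤n
δ-xor true true false true = s≤s z≤n
δ-xor true true false false = z≤n
δ-xor true false true true = s≤s z≤n
δ-xor true false true false = z≤n
δ-xor true false false true = z≤n
δ-xor true false false false = s≤s z≤n
δ-xor false true true true = s≤s z≤n
δ-xor false true true false = z≤n
δ-xor false true false true = z≤n
δ-xor false true false false = s≤s z≤n
δ-xor false false true true = z≤n
δ-xor false false true false = s≤s z≤n
δ-xor false false false true = s≤s z≤n
δ-xor false false false false = z≤n

dist-⊕ : ∀ {n} (x y z w : Cube n) → dist (x ⊕ z) (y ⊕ w) ≤ dist x y + dist z w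
dist-⊕ [] [] [] [] = z≤n
dist-⊕ (a ∷ x) (b ∷ y) (c ∷ z) (d ∷ w) =
  ≤-trans (+-mono-≤ (δ-xor a b c d) (dist-⊕ x y z w))
          (≤-reflexive (+-interchange (δ a b) (δ c d) (dist x y) (dist z w)))

dist-⊕-translate : ∀ {n} (x y z : Cube n) → dist x (x ⊕ (y ⊕ z)) ≡ dist y z
dist-⊕-translate [] [] [] = refl
dist-⊕-translate (a ∷ x) (b ∷ y) (c ∷ z) = cong₂ _+_ (lem a b c) (dist-⊕-translate x y z)
  where
  lem : ∀ a b c → δ a (a xor (b xor c)) ≡ δ b c
  lem true true true = refl
  lem true true false = refl
  lem true false true = refl
  lem true false false = refl
  lem false true true = refl
  lem false true false = refl
  lem false false true = refl
  lem false false false = refl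

parity : ∀ {n} → Cube n → Bool
parity [] = false
parity (a ∷ x) = a xor parity x

dist-parity : ∀ {n} (x y : Cube n) → δ (parity x) (parity y) ≤ dist x y
dist-parity [] [] = z≤n
dist-parity (a ∷ x) (b ∷ y) =
  ≤-trans (δ-xor a b (parity x) (parity y)) (+-monoʳ-≤ (δ a b) (dist-parity x y))

-- A point at distance at most one from x either is x or has the other parity.
dist-flipped-parity : ∀ {n} (x y : Cube n) → dist x y ≤ 1 →
  δ (parity x) (parity y xor true) + dist x y ≤ 1
dist-flipped-parity x y d≤1 with dist x y in eq
dist-flipped-parity x y d≤1 | zero rewrite dist≡0⇒≡ x y eq with parity y
... | true = s≤s z≤n
... | false = s≤s z≤n
dist-flipped-parity x y (s≤s z≤n) | suc zero = ≤-reflexive (cong (_+ 1) (unit-flip x y eq))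
  where
  δ-step : ∀ a p q → δ p (q xor true) ≡ 0 → δ (a xor p) ((a xor q) xor true) ≡ 0
  δ-step true true false _ = refl
  δ-step true false true _ = refl
  δ-step false true false _ = refl
  δ-step false false true _ = refl
  δ-step true true true ()
  δ-step true false false ()
  δ-step false true true ()
  δ-step false false false ()
  unit-flip : ∀ {n} (x y : Cube n) → dist x y ≡ 1 → δ (parity x) (parity y xor true) ≡ 0
  unit-flip [] [] ()
  unit-flip (true ∷ x) (true ∷ y) p = δ-step true (parity x) (parity y) (unit-flip x y p)
  unit-flip (false ∷ x) (false ∷ y) p = δ-step false (parity x) (parity y) (unit-flip x y p)
  unit-flip (true ∷ x) (false ∷ y) p rewrite dist≡0⇒≡ x y (suc-injective p) with parity y
  ... | true = refl
  ... | false = refl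
  unit-flip (false ∷ x) (true ∷ y) p rewrite dist≡0⇒≡ x y (suc-injective p) with parity y
  ... | true = refl
  ... | false = refl

-- Partitions of the cube into products of radius-1 balls.

zeros : ∀ {n} → Cube n
zeros = replicate _ false

-- A partition of Cube n into blocks point v _ of size 2ᵉ, indexed by v ∈ Cube d; point v zeros is the centre.
record Blocks (n d e α : ℕ) : Set where
  field
    point : Cube d → Cube e → Cube n
    index : Cube n → Cube d
    label : Cube n → Cube e
    index-point : ∀ v a → index (point v a) ≡ v
    label-point : ∀ v a → label (point v a) ≡ a
    point-index : ∀ x → point (index x) (label x) ≡ x
    dist-label : ∀ v a → dist (point v zeros) (point v a) ≤ α
    -- The factor 3 is the one that `doubling` reproduces: flipping a bit of `u` changes both halves
    -- of the point and the parity bit, and an index bit of the shorter code already costs up to 3.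
    dist-index : ∀ v w → dist (point v zeros) (point w zeros) ≤ 3 * dist v w
    d≤n : d ≤ n

  dist-point : ∀ v w a b → dist v w ≤ 1 → dist (point v a) (point w b) ≤ α + (3 + α)
  dist-point v w a b vw≤1 = begin
    dist (point v a) (point w b)
      ≤⟨ dist-triangle (point v a) (point v zeros) (point w b) ⟩
    dist (point v a) (point v zeros) + dist (point v zeros) (point w b)
      ≤⟨ +-mono-≤ (≤-trans (≤-reflexive (dist-sym (point v a) _)) (dist-label v a))
           (dist-triangle (point v zeros) (point w zeros) (point w b)) ⟩
    α + (dist (point v zeros) (point w zeros) + dist (point w zeros) (point w b))
      ≤⟨ +-monoʳ-≤ α (+-mono-≤ (≤-trans (dist-index v w) (*-monoʳ-≤ 3 vw≤1)) (dist-label w b)) ⟩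
    α + (3 + α) ∎
    where open ≤-Reasoning

trivial : ∀ n → Blocks n n 0 0
trivial n = record
  { point = λ v _ → v
  ; index = λ x → x
  ; label = λ _ → []
  ; index-point = λ _ _ → refl
  ; label-point = λ { _ [] → refl }
  ; point-index = λ _ → refl
  ; dist-label = λ v _ → ≤-reflexive (dist-refl v)
  ; dist-index = λ _ _ → m≤m+n _ _
  ; d≤n = ≤-refl
  }

zeros-++ : ∀ m n → zeros {m + n} ≡ zeros {m} ++ᵥ zeros {n}
zeros-++ zero n = refl
zeros-++ (suc m) n = cong (false ∷_) (zeros-++ m n)

_⊗_ : ∀ {n₁ n₂ d₁ d₂ e₁ e₂ α₁ α₂} → Blocks n₁ d₁ e₁ α₁ → Blocks n₂ d₂ e₂ α₂ →
  Blocks (n₁ + n₂) (d₁ + d₂) (e₁ + e₂) (α₁ + α₂)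
_⊗_ {n₁} {n₂} {d₁} {d₂} {e₁} {e₂} {α₁} {α₂} B C = record
  { point = pt
  ; index = ix
  ; label = lb
  ; index-point = λ v a → trans
      (cong₂ _++ᵥ_ (trans (cong (index B) (take-++ (pt₁ v a) _)) (index-point B _ _))
                  (trans (cong (index C) (drop-++ (pt₁ v a) _)) (index-point C _ _)))
      (takeᵥ++dropᵥ≡id d₁ v)
  ; label-point = λ v a → trans
      (cong₂ _++ᵥ_ (trans (cong (label B) (take-++ (pt₁ v a) _)) (label-point B _ _))
                  (trans (cong (label C) (drop-++ (pt₁ v a) _)) (label-point C _ _)))
      (takeᵥ++dropᵥ≡id e₁ a)
  ; point-index = λ x → trans
      (cong₂ _++ᵥ_
        (trans (cong₂ (point B) (take-++ (index B (takeᵥ n₁ x)) _) (take-++ (label B (takeᵥ n₁ x)) _)) (point-index B _))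
        (trans (cong₂ (point C) (drop-++ (index B (takeᵥ n₁ x)) _) (drop-++ (label B (takeᵥ n₁ x)) _)) (point-index C _)))
      (takeᵥ++dropᵥ≡id n₁ x)
  ; dist-label = λ v a → begin
      dist (pt v zeros) (pt v a)
        ≡⟨ cong (λ z → dist z (pt v a)) (pt-zeros v) ⟩
      dist (point B (takeᵥ d₁ v) zeros ++ᵥ point C (dropᵥ d₁ v) zeros) (pt v a)
        ≡⟨ dist-++ (point B (takeᵥ d₁ v) zeros) _ _ _ ⟩
      _ ≤⟨ +-mono-≤ (dist-label B _ _) (dist-label C _ _) ⟩
      α₁ + α₂ ∎
  ; dist-index = λ v w → begin
      dist (pt v zeros) (pt w zeros)
        ≡⟨ cong₂ dist (pt-zeros v) (pt-zeros w) ⟩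
      _ ≡⟨ dist-++ (point B (takeᵥ d₁ v) zeros) _ _ _ ⟩
      _ ≤⟨ +-mono-≤ (dist-index B _ _) (dist-index C _ _) ⟩
      3 * dist (takeᵥ d₁ v) (takeᵥ d₁ w) + 3 * dist (dropᵥ d₁ v) (dropᵥ d₁ w)
        ≡⟨ *-distribˡ-+ 3 (dist (takeᵥ d₁ v) (takeᵥ d₁ w)) _ ⟨
      3 * (dist (takeᵥ d₁ v) (takeᵥ d₁ w) + dist (dropᵥ d₁ v) (dropᵥ d₁ w))
        ≡⟨ cong (3 *_) (dist-++ (takeᵥ d₁ v) _ _ _) ⟨
      3 * dist (takeᵥ d₁ v ++ᵥ dropᵥ d₁ v) (takeᵥ d₁ w ++ᵥ dropᵥ d₁ w)
        ≡⟨ cong (3 *_) (cong₂ dist (takeᵥ++dropᵥ≡id d₁ v) (takeᵥ++dropᵥ≡id d₁ w)) ⟩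
      3 * dist v w ∎
  ; d≤n = +-mono-≤ (d≤n B) (d≤n C)
  }
  where
  open Blocks
  open ≤-Reasoning
  pt₁ : Cube (d₁ + d₂) → Cube (e₁ + e₂) → Cube n₁
  pt₁ v a = point B (takeᵥ d₁ v) (takeᵥ e₁ a)
  pt : Cube (d₁ + d₂) → Cube (e₁ + e₂) → Cube (n₁ + n₂)
  pt v a = pt₁ v a ++ᵥ point C (dropᵥ d₁ v) (dropᵥ e₁ a)
  ix : Cube (n₁ + n₂) → Cube (d₁ + d₂)
  ix x = index B (takeᵥ n₁ x) ++ᵥ index C (dropᵥ n₁ x)
  lb : Cube (n₁ + n₂) → Cube (e₁ + e₂)
  lb x = label B (takeᵥ n₁ x) ++ᵥ label C (dropᵥ n₁ x)
  pt-zeros : ∀ v → pt v zeros ≡ point B (takeᵥ d₁ v) zeros ++ᵥ point C (dropᵥ d₁ v) zeros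
  pt-zeros v rewrite zeros-++ e₁ e₂ | take-++ (zeros {e₁}) (zeros {e₂}) | drop-++ (zeros {e₁}) (zeros {e₂}) = refl

-- The (u, u + v) construction of the Hamming code of length 2ℓ + 1: a point is (p, u, v), and u ⊕ v carries
-- the label s and part of the index of the shorter code. The extra label bit q says whether u or v has to be
-- corrected to reach the codeword; it is recorded by the parity bit p, which leaves p itself to be the
-- corrected coordinate when u ⊕ v is a codeword.
doubling : ∀ {ℓ d e} → Blocks ℓ d e 1 → Blocks (suc (ℓ + ℓ)) (ℓ + d) (suc e) 1
doubling {ℓ} {d} {e} B = record
  { point = pt
  ; index = ix
  ; label = lb
  ; index-point = λ { v (q ∷ s) → ix-pt v q s }
  ; label-point = λ { v (q ∷ s) → lb-pt v q s }
  ; point-index = λ { (p ∷ x) → pt-ix p x }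
  ; dist-label = λ { v (q ∷ s) → dist-lb v q s }
  ; dist-index = dist-ix
  ; d≤n = m≤n⇒m≤1+n (+-monoʳ-≤ ℓ (d≤n B))
  }
  where
  open Blocks
  open ≤-Reasoning
  Ψ = point B
  -- The translation vector is the error of `u ⊕ v`, of weight at most 1. Adding it twice does
  -- nothing, so the same `shift` encodes in `pt` and decodes in `ix`.
  shift : Bool → Cube ℓ → Cube d → Cube e → Cube ℓ
  shift false u a s = u
  shift true u a s = u ⊕ (Ψ a zeros ⊕ Ψ a s)
  shift-shift : ∀ q u a s → shift q (shift q u a s) a s ≡ u
  shift-shift false u a s = refl
  shift-shift true u a s = ⊕-cancelʳ u _
  glue : Bool → Cube ℓ → Cube ℓ → Cube (suc (ℓ + ℓ))
  glue q w v = (parity v xor q) ∷ ((v ⊕ w) ++ᵥ v)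
  pt : Cube (ℓ + d) → Cube (suc e) → Cube (suc (ℓ + ℓ))
  pt i (q ∷ s) = glue q (Ψ a s) (shift q (takeᵥ ℓ i) a s)
    where a = dropᵥ ℓ i
  u⊕v : Cube (ℓ + ℓ) → Cube ℓ
  u⊕v x = takeᵥ ℓ x ⊕ dropᵥ ℓ x
  lb : Cube (suc (ℓ + ℓ)) → Cube (suc e)
  lb (p ∷ x) = (p xor parity (dropᵥ ℓ x)) ∷ label B (u⊕v x)
  ix : Cube (suc (ℓ + ℓ)) → Cube (ℓ + d)
  ix (p ∷ x) = shift (p xor parity (dropᵥ ℓ x)) (dropᵥ ℓ x) (index B (u⊕v x)) (label B (u⊕v x)) ++ᵥ index B (u⊕v x)

  ⊕-glue : ∀ (v w : Cube ℓ) → u⊕v ((v ⊕ w) ++ᵥ v) ≡ w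
  ⊕-glue v w rewrite take-++ (v ⊕ w) v | drop-++ (v ⊕ w) v = ⊕-cancelˡ v w

  ix-pt : ∀ i q s → ix (pt i (q ∷ s)) ≡ i
  ix-pt i q s
    rewrite ⊕-glue (shift q (takeᵥ ℓ i) (dropᵥ ℓ i) s) (Ψ (dropᵥ ℓ i) s)
          | drop-++ (shift q (takeᵥ ℓ i) (dropᵥ ℓ i) s ⊕ Ψ (dropᵥ ℓ i) s) (shift q (takeᵥ ℓ i) (dropᵥ ℓ i) s)
          | xor-cancelˡ (parity (shift q (takeᵥ ℓ i) (dropᵥ ℓ i) s)) q
          | index-point B (dropᵥ ℓ i) s | label-point B (dropᵥ ℓ i) s
          | shift-shift q (takeᵥ ℓ i) (dropᵥ ℓ i) s
    = takeᵥ++dropᵥ≡id ℓ i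

  lb-pt : ∀ i q s → lb (pt i (q ∷ s)) ≡ q ∷ s
  lb-pt i q s
    rewrite ⊕-glue (shift q (takeᵥ ℓ i) (dropᵥ ℓ i) s) (Ψ (dropᵥ ℓ i) s)
          | drop-++ (shift q (takeᵥ ℓ i) (dropᵥ ℓ i) s ⊕ Ψ (dropᵥ ℓ i) s) (shift q (takeᵥ ℓ i) (dropᵥ ℓ i) s)
          | xor-cancelˡ (parity (shift q (takeᵥ ℓ i) (dropᵥ ℓ i) s)) q
          | label-point B (dropᵥ ℓ i) s
    = refl

  pt-ix : ∀ p x → pt (ix (p ∷ x)) (lb (p ∷ x)) ≡ p ∷ x
  pt-ix p x
    rewrite take-++ (shift (p xor parity (dropᵥ ℓ x)) (dropᵥ ℓ x) (index B (u⊕v x)) (label B (u⊕v x))) (index B (u⊕v x))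
          | drop-++ (shift (p xor parity (dropᵥ ℓ x)) (dropᵥ ℓ x) (index B (u⊕v x)) (label B (u⊕v x))) (index B (u⊕v x))
          | shift-shift (p xor parity (dropᵥ ℓ x)) (dropᵥ ℓ x) (index B (u⊕v x)) (label B (u⊕v x))
          | point-index B (u⊕v x)
    = cong₂ _∷_ (lem p (parity (dropᵥ ℓ x)))
        (trans (cong (_++ᵥ dropᵥ ℓ x) (lem′ (takeᵥ ℓ x) (dropᵥ ℓ x))) (takeᵥ++dropᵥ≡id ℓ x))
    where
    lem : ∀ p q → q xor (p xor q) ≡ p
    lem true true = refl
    lem true false = refl
    lem false true = refl
    lem false false = refl
    lem′ : ∀ {n} (x y : Cube n) → y ⊕ (x ⊕ y) ≡ x
    lem′ [] [] = refl
    lem′ (a ∷ x) (b ∷ y) = cong₂ _∷_ (lem a b) (lem′ x y)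

  dist-lb : ∀ i q s → dist (pt i zeros) (pt i (q ∷ s)) ≤ 1
  dist-lb i false s = begin
    δ (parity u xor false) (parity u xor false) + dist ((u ⊕ Ψ a zeros) ++ᵥ u) ((u ⊕ Ψ a s) ++ᵥ u)
      ≡⟨ cong₂ _+_ (δ-refl (parity u xor false)) (dist-++ (u ⊕ Ψ a zeros) _ u u) ⟩
    dist (u ⊕ Ψ a zeros) (u ⊕ Ψ a s) + dist u u
      ≤⟨ +-monoˡ-≤ _ (dist-⊕ u u _ _) ⟩
    dist u u + dist (Ψ a zeros) (Ψ a s) + dist u u
      ≡⟨ cong (λ k → k + dist (Ψ a zeros) (Ψ a s) + k) (dist-refl u) ⟩
    dist (Ψ a zeros) (Ψ a s) + 0
      ≡⟨ +-identityʳ _ ⟩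
    dist (Ψ a zeros) (Ψ a s)
      ≤⟨ dist-label B a s ⟩
    1 ∎
    where
    u = takeᵥ ℓ i
    a = dropᵥ ℓ i
    δ-refl : ∀ p → δ p p ≡ 0
    δ-refl true = refl
    δ-refl false = refl
  -- The first halves agree here, and the second halves differ by the error. A nonzero error flips
  -- the parity of `v`, which the extra `true` undoes; a zero error leaves only the flipped parity
  -- bit. Either way exactly one coordinate changes.
  dist-lb i true s = begin
    δ (parity u xor false) (parity v xor true) + dist ((u ⊕ Ψ a zeros) ++ᵥ u) ((v ⊕ Ψ a s) ++ᵥ v)
      ≡⟨ cong₂ (λ p z → δ p (parity v xor true) + dist ((u ⊕ Ψ a zeros) ++ᵥ u) (z ++ᵥ v)) (xor-identityʳ (parity u)) (lem u _ _) ⟩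
    δ (parity u) (parity v xor true) + dist ((u ⊕ Ψ a zeros) ++ᵥ u) ((u ⊕ Ψ a zeros) ++ᵥ v)
      ≡⟨ cong (δ (parity u) (parity v xor true) +_) (trans (dist-++ (u ⊕ Ψ a zeros) _ u v) (cong (_+ dist u v) (dist-refl (u ⊕ Ψ a zeros)))) ⟩
    δ (parity u) (parity v xor true) + dist u v
      ≤⟨ dist-flipped-parity u v (≤-trans (≤-reflexive (dist-⊕-translate u _ _)) (dist-label B a s)) ⟩
    1 ∎
    where
    u = takeᵥ ℓ i
    a = dropᵥ ℓ i
    v = u ⊕ (Ψ a zeros ⊕ Ψ a s)
    bit : ∀ x y z → (x xor (y xor z)) xor z ≡ x xor y
    bit true y z = lem₂ y z
      where
      lem₂ : ∀ y z → not (y xor z) xor z ≡ not y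
      lem₂ true true = refl
      lem₂ true false = refl
      lem₂ false true = refl
      lem₂ false false = refl
    bit false y z = xor-cancelʳ y z
    lem : ∀ {n} (x y z : Cube n) → (x ⊕ (y ⊕ z)) ⊕ z ≡ x ⊕ y
    lem [] [] [] = refl
    lem (a ∷ x) (b ∷ y) (c ∷ z) = cong₂ _∷_ (bit a b c) (lem x y z)

  dist-ix : ∀ i j → dist (pt i zeros) (pt j zeros) ≤ 3 * dist i j
  dist-ix i j = begin
    δ (parity u xor false) (parity v xor false) + dist ((u ⊕ Ψ a zeros) ++ᵥ u) ((v ⊕ Ψ b zeros) ++ᵥ v)
      ≡⟨ cong₂ _+_ (cong₂ δ (xor-identityʳ (parity u)) (xor-identityʳ (parity v))) (dist-++ (u ⊕ Ψ a zeros) _ u v) ⟩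
    δ (parity u) (parity v) + (dist (u ⊕ Ψ a zeros) (v ⊕ Ψ b zeros) + dist u v)
      ≤⟨ +-mono-≤ (dist-parity u v) (+-monoˡ-≤ (dist u v)
           (≤-trans (dist-⊕ u v _ _) (+-monoʳ-≤ (dist u v) (dist-index B a b)))) ⟩
    dist u v + (dist u v + 3 * dist a b + dist u v)
      ≡⟨ lem (dist u v) (dist a b) ⟩
    3 * (dist u v + dist a b)
      ≡⟨ cong (3 *_) (trans (sym (dist-++ u v a b)) (cong₂ dist (takeᵥ++dropᵥ≡id ℓ i) (takeᵥ++dropᵥ≡id ℓ j))) ⟩
    3 * dist i j ∎
    where
    u = takeᵥ ℓ i
    v = takeᵥ ℓ j
    a = dropᵥ ℓ i
    b = dropᵥ ℓ j
    lem : ∀ x y → x + (x + 3 * y + x) ≡ 3 * (x + y)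
    lem = solve-∀

hammingLength : ℕ → ℕ
hammingLength zero = 0
hammingLength (suc r) = suc (hammingLength r + hammingLength r)

hammingLength-2^ : ∀ r → suc (hammingLength r) ≡ 2 ^ r
hammingLength-2^ zero = refl
hammingLength-2^ (suc r) = trans (lem (hammingLength r)) (cong (2 *_) (hammingLength-2^ r))
  where
  lem : ∀ x → suc (suc (x + x)) ≡ 2 * suc x
  lem = solve-∀

-- This is 2ʳ - 1 - r, the dimension of the Hamming code. The closed form is avoided, since the
-- later estimates only rely on the field `d≤n`.
hammingDim : ℕ → ℕ
hammingDim zero = 0
hammingDim (suc r) = hammingLength r + hammingDim r

hamming : ∀ r → Blocks (hammingLength r) (hammingDim r) r 1
hamming zero = record
  { Blocks (trivial 0)
  ; dist-label = λ v a → ≤-trans (Blocks.dist-label (trivial 0) v a) z≤n }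
hamming (suc r) = doubling (hamming r)

-- Bounded flow on the cube

total : ∀ {d} → (Cube d → ℕ) → ℕ
total {zero} f = f []
total {suc d} f = total (λ v → f (false ∷ v)) + total (λ v → f (true ∷ v))

total-mono : ∀ {d} {f g : Cube d → ℕ} → (∀ v → f v ≤ g v) → total f ≤ total g
total-mono {zero} f≤g = f≤g []
total-mono {suc d} f≤g = +-mono-≤ (total-mono (f≤g ∘ (false ∷_))) (total-mono (f≤g ∘ (true ∷_)))

total-cong : ∀ {d} {f g : Cube d → ℕ} → (∀ v → f v ≡ g v) → total f ≡ total g
total-cong {zero} f≡g = f≡g []
total-cong {suc d} f≡g = cong₂ _+_ (total-cong (f≡g ∘ (false ∷_))) (total-cong (f≡g ∘ (true ∷_)))

total-+ : ∀ {d} (f g : Cube d → ℕ) → total (λ v → f v + g v) ≡ total f + total g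
total-+ {zero} f g = refl
total-+ {suc d} f g =
  trans (cong₂ _+_ (total-+ (f ∘ (false ∷_)) (g ∘ (false ∷_))) (total-+ (f ∘ (true ∷_)) (g ∘ (true ∷_))))
        (+-interchange (total (f ∘ (false ∷_))) _ _ _)

total-const : ∀ d c → total {d} (λ _ → c) ≡ c * 2 ^ d
total-const zero c = sym (*-identityʳ c)
total-const (suc d) c = trans (cong₂ _+_ (total-const d c) (total-const d c)) (lem c (2 ^ d))
  where
  lem : ∀ c x → c * x + c * x ≡ c * (2 * x)
  lem = solve-∀

-- Repeated halving follows the recursion of `total`, so the exact sum and both bounds on the shares
-- are inductions on `d`.
spread : ∀ d → ℕ → Cube d → ℕ
spread zero s _ = s
spread (suc d) s (b ∷ v) = spread d (if b then ⌈ s /2⌉ else ⌊ s /2⌋) v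

total-spread : ∀ d s → total (spread d s) ≡ s
total-spread zero s = refl
total-spread (suc d) s =
  trans (cong₂ _+_ (total-spread d ⌊ s /2⌋) (total-spread d ⌈ s /2⌉)) (⌊n/2⌋+⌈n/2⌉≡n s)

spread-upper : ∀ d s c → s ≤ c * 2 ^ d → ∀ v → spread d s v ≤ c
spread-upper zero s c s≤c [] = ≤-trans s≤c (≤-reflexive (*-identityʳ c))
spread-upper (suc d) s c s≤c (b ∷ v) = spread-upper d _ c (half b) v
  where
  s≤2c : s ≤ c * 2 ^ d + c * 2 ^ d
  s≤2c = ≤-trans s≤c (≤-reflexive (lem c (2 ^ d)))
    where
    lem : ∀ c x → c * (2 * x) ≡ c * x + c * x
    lem = solve-∀
  half : ∀ b → (if b then ⌈ s /2⌉ else ⌊ s /2⌋) ≤ c * 2 ^ d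
  half true = ≤-trans (⌈n/2⌉-mono s≤2c) (≤-reflexive (sym (n≡⌈n+n/2⌉ (c * 2 ^ d))))
  half false = ≤-trans (⌊n/2⌋-mono s≤2c) (≤-reflexive (sym (n≡⌊n+n/2⌋ (c * 2 ^ d))))

spread-lower : ∀ d s c → c * 2 ^ d ≤ s → ∀ v → c ≤ spread d s v
spread-lower zero s c c≤s [] = ≤-trans (≤-reflexive (sym (*-identityʳ c))) c≤s
spread-lower (suc d) s c c≤s (b ∷ v) = spread-lower d _ c (half b) v
  where
  2c≤s : c * 2 ^ d + c * 2 ^ d ≤ s
  2c≤s = ≤-trans (≤-reflexive (lem c (2 ^ d))) c≤s
    where
    lem : ∀ c x → c * x + c * x ≡ c * (2 * x)
    lem = solve-∀
  half : ∀ b → c * 2 ^ d ≤ (if b then ⌈ s /2⌉ else ⌊ s /2⌋)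
  half true = ≤-trans (≤-reflexive (n≡⌈n+n/2⌉ (c * 2 ^ d))) (⌈n/2⌉-mono 2c≤s)
  half false = ≤-trans (≤-reflexive (n≡⌊n+n/2⌋ (c * 2 ^ d))) (⌊n/2⌋-mono 2c≤s)

-- Every share lies between the quotient of `s` by 2ᵈ and that quotient plus one.
spread-even : ∀ d s v w → spread d s v ≤ suc (spread d s w)
spread-even d s v w =
  ≤-trans (spread-upper d s (suc τ) s≤ v) (s≤s (spread-lower d s τ (m/n*n≤m s (2 ^ d)) w))
  where
  instance _ = m^n≢0 2 d
  τ = s / 2 ^ d
  s≤ : s ≤ suc τ * 2 ^ d
  s≤ = ≤-trans (≤-reflexive (m≡m%n+[m/n]*n s (2 ^ d))) (+-monoˡ-≤ _ (<⇒≤ (m%n<n s (2 ^ d))))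

-- Families of lists over the cube and matchings between them.

gather : ∀ {X : Set} {d} → (Cube d → List X) → List X
gather {d = zero} l = l []
gather {d = suc d} l = gather (λ v → l (false ∷ v)) ++ gather (λ v → l (true ∷ v))

module _ {X : Set} where

  length-gather : ∀ {d} (l : Cube d → List X) → length (gather l) ≡ total (length ∘ l)
  length-gather {zero} l = refl
  length-gather {suc d} l =
    trans (length-++ (gather (l ∘ (false ∷_))))
          (cong₂ _+_ (length-gather (l ∘ (false ∷_))) (length-gather (l ∘ (true ∷_))))

  ++-interchange-↭ : (as bs cs ds : List X) → as ++ (bs ++ (cs ++ ds)) ↭ (as ++ cs) ++ (bs ++ ds)
  ++-interchange-↭ as bs cs ds =
    ↭-trans (++⁺ˡ as (shifts bs cs)) (↭-reflexive (sym (++-assoc as cs (bs ++ ds))))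

  gather-++ : ∀ {d} (l m : Cube d → List X) → gather l ++ gather m ↭ gather (λ v → l v ++ m v)
  gather-++ {zero} l m = ↭-refl
  gather-++ {suc d} l m =
    ↭-trans (↭-reflexive (++-assoc (gather (l ∘ (false ∷_))) _ _))
    (↭-trans (++-interchange-↭ (gather (l ∘ (false ∷_))) (gather (l ∘ (true ∷_))) _ _)
    (++⁺ (gather-++ (l ∘ (false ∷_)) (m ∘ (false ∷_))) (gather-++ (l ∘ (true ∷_)) (m ∘ (true ∷_)))))

  gather-cong : ∀ {d} {l m : Cube d → List X} → (∀ v → l v ≡ m v) → gather l ≡ gather m
  gather-cong {zero} l≡m = l≡m []
  gather-cong {suc d} l≡m = cong₂ _++_ (gather-cong (l≡m ∘ (false ∷_))) (gather-cong (l≡m ∘ (true ∷_)))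

  gather-take-drop : ∀ {d} (p : Cube d → ℕ) (l : Cube d → List X) →
    gather (λ v → take (p v) (l v)) ++ gather (λ v → drop (p v) (l v)) ↭ gather l
  gather-take-drop p l =
    ↭-trans (gather-++ (λ v → take (p v) (l v)) (λ v → drop (p v) (l v))) (↭-reflexive (gather-cong (λ v → take++drop≡id (p v) (l v))))

  ∈-take : ∀ n (xs : List X) {x} → x ∈ take n xs → x ∈ xs
  ∈-take n xs x∈ = subst (_ ∈_) (take++drop≡id n xs) (∈-++⁺ˡ x∈)

  ∈-drop : ∀ n (xs : List X) {x} → x ∈ drop n xs → x ∈ xs
  ∈-drop n xs x∈ = subst (_ ∈_) (take++drop≡id n xs) (∈-++⁺ʳ (take n xs) x∈)

  length-split : ∀ n (xs : List X) → n ≤ length xs → length xs ≡ n + length (drop n xs)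
  length-split n xs n≤ = trans (sym (m+[n∸m]≡n n≤)) (cong (n +_) (sym (length-drop n xs)))

  -- Requiring the projections to agree with the lists only up to permutation lets matchings of
  -- disjoint pieces be concatenated and then rearranged, which is how the flow is put together.
  record Matching (R : X → X → Set) (as bs : List X) : Set where
    constructor matching
    field
      pairs : List (X × X)
      lefts : map proj₁ pairs ↭ as
      rights : map proj₂ pairs ↭ bs
      related : All (uncurry R) pairs

  module _ {R : X → X → Set} where

    match-++ : ∀ {as bs cs ds} → Matching R as bs → Matching R cs ds → Matching R (as ++ cs) (bs ++ ds)
    match-++ (matching ps l r h) (matching qs l′ r′ h′) = matching (ps ++ qs)
      (↭-trans (↭-reflexive (map-++ proj₁ ps qs)) (++⁺ l l′))
      (↭-trans (↭-reflexive (map-++ proj₂ ps qs)) (++⁺ r r′))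
      (All-++⁺ h h′)

    match-↭ : ∀ {as bs cs ds} → as ↭ cs → bs ↭ ds → Matching R as bs → Matching R cs ds
    match-↭ p q (matching ps l r h) = matching ps (↭-trans l p) (↭-trans r q) h

    match-zip : ∀ as bs → length as ≡ length bs → (∀ {x y} → x ∈ as → y ∈ bs → R x y) → Matching R as bs
    match-zip [] [] _ _ = matching [] ↭-refl ↭-refl []
    match-zip (a ∷ as) (b ∷ bs) eq r with match-zip as bs (suc-injective eq) (λ x∈ y∈ → r (there x∈) (there y∈))
    ... | matching ps l r′ h = matching ((a , b) ∷ ps) (_↭_.prep a l) (_↭_.prep b r′) (r (here refl) (here refl) ∷ h)

    match-gather : ∀ {d} (la lb : Cube d → List X) → (∀ v → Matching R (la v) (lb v)) →
      Matching R (gather la) (gather lb)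
    match-gather {zero} la lb m = m []
    match-gather {suc d} la lb m =
      match-++ (match-gather _ _ (m ∘ (false ∷_))) (match-gather _ _ (m ∘ (true ∷_)))

-- An upper bound for what the remaining `d` directions take from one list: at most `2W` points in
-- the current direction, after which the oscillation is `W + 1`.
capacity : ℕ → ℕ → ℕ
capacity zero W = 0
capacity (suc d) W = (W + W) + capacity d (suc W)

module _ {d} (a b : Cube d → ℕ) (W : ℕ) where

  -- Averaging over `w`: the mean of `a - b` is zero, and no value exceeds the mean by more than the
  -- oscillation.
  bounded-excess : total a ≡ total b → (∀ v w → a v + b w ≤ a w + b v + W) → ∀ v → a v ≤ b v + W
  bounded-excess ta≡tb osc v = *-cancelʳ-≤ (a v) (b v + W) (2 ^ d) {{m^n≢0 2 d}} (+-cancelʳ-≤ (total b) _ _ (begin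
    a v * 2 ^ d + total b
      ≡⟨ cong (_+ total b) (total-const d (a v)) ⟨
    total {d} (λ _ → a v) + total b
      ≡⟨ total-+ (λ _ → a v) b ⟨
    total (λ w → a v + b w)
      ≤⟨ total-mono (λ w → ≤-trans (osc v w) (≤-reflexive (trans (+-assoc (a w) _ _) (+-comm (a w) _)))) ⟩
    total (λ w → (b v + W) + a w)
      ≡⟨ total-+ (λ _ → b v + W) a ⟩
    total {d} (λ _ → b v + W) + total a
      ≡⟨ cong₂ _+_ (total-const d (b v + W)) ta≡tb ⟩
    (b v + W) * 2 ^ d + total b ∎))
    where open ≤-Reasoning

-- First equalise the two halves along the first direction, then recurse. Every edge carries W units one way, and
-- W plus its share of the excess of one half the other way, which avoids a case distinction on the sign of the excess.
-- Since the shares differ by at most one, the oscillation W grows by at most one per direction.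
flow : ∀ {X : Set} {R : X → X → Set} d (la lb : Cube d → List X) W →
  total (length ∘ la) ≡ total (length ∘ lb) →
  (∀ v w → length (la v) + length (lb w) ≤ length (la w) + length (lb v) + W) →
  (∀ v → capacity d W ≤ length (la v)) → (∀ v → capacity d W ≤ length (lb v)) →
  (∀ v w → dist v w ≤ 1 → ∀ {x y} → x ∈ la v → y ∈ lb w → R x y) →
  Matching R (gather la) (gather lb)
flow zero la lb W eq osc ca cb r = match-zip (la []) (lb []) eq (r [] [] z≤n)
flow {X} {R} (suc d) la lb W eq osc ca cb r =
  match-↭
    -- The pieces of `lb` arrive in the order `U₁`, `U₀`, because points leaving one half are
    -- matched in the other; this explains the additional `shifts` on that side.
    (↭-trans (++-interchange-↭ T₀ T₁ _ _) (++⁺ (gather-take-drop p la₀) (gather-take-drop (λ _ → W) la₁)))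
    (↭-trans (shifts U₁ U₀) (↭-trans (++-interchange-↭ U₀ U₁ _ _)
      (++⁺ (gather-take-drop (λ _ → W) lb₀) (gather-take-drop p lb₁))))
    (match-++ across₀₁ (match-++ across₁₀ (match-++ within₀ within₁)))
  where
  la₀ la₁ lb₀ lb₁ : Cube d → List X
  la₀ v = la (false ∷ v)
  la₁ v = la (true ∷ v)
  lb₀ v = lb (false ∷ v)
  lb₁ v = lb (true ∷ v)
  A₀ = total (length ∘ la₀)
  A₁ = total (length ∘ la₁)
  B₀ = total (length ∘ lb₀)
  B₁ = total (length ∘ lb₁)
  V = W * 2 ^ d
  total-excess : (f g : Cube d → ℕ) → (∀ v → f v ≤ g v + W) → total f ≤ total g + V
  total-excess f g f≤ = ≤-trans (total-mono f≤)
    (≤-reflexive (trans (total-+ g (λ _ → W)) (cong (total g +_) (total-const d W))))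
  osc′ : ∀ v w → length (lb v) + length (la w) ≤ length (lb w) + length (la v) + W
  osc′ v w = ≤-trans (≤-reflexive (+-comm (length (lb v)) _))
    (≤-trans (osc w v) (≤-reflexive (cong (_+ W) (+-comm (length (la v)) _))))
  A₀≤ : A₀ ≤ B₀ + V
  A₀≤ = total-excess _ _ (λ v → bounded-excess (length ∘ la) (length ∘ lb) W eq osc (false ∷ v))
  B₀≤ : B₀ ≤ A₀ + V
  B₀≤ = total-excess _ _ (λ v → bounded-excess (length ∘ lb) (length ∘ la) W (sym eq) osc′ (false ∷ v))
  -- The bound `B₀≤` makes this subtraction exact. With `S` units sent from the half `false` and `V`
  -- sent back, the net transfer is `A₀ - B₀`, of whichever sign.
  S = A₀ + V ∸ B₀
  S+B₀ : S + B₀ ≡ A₀ + V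
  S+B₀ = m∸n+n≡m B₀≤
  S≤ : S ≤ (W + W) * 2 ^ d
  S≤ = +-cancelʳ-≤ B₀ _ _ (≤-trans (≤-reflexive S+B₀) (≤-trans (+-monoˡ-≤ V A₀≤) (≤-reflexive (lem B₀ W (2 ^ d)))))
    where
    lem : ∀ b w x → b + w * x + w * x ≡ (w + w) * x + b
    lem = solve-∀
  p : Cube d → ℕ
  p = spread d S
  T₀ = gather (λ v → take (p v) (la₀ v))
  T₁ = gather (λ v → take W (la₁ v))
  U₀ = gather (λ v → take W (lb₀ v))
  U₁ = gather (λ v → take (p v) (lb₁ v))
  enough-p : ∀ {k} v → capacity (suc d) W ≤ k → p v ≤ k
  enough-p v c≤ = ≤-trans (spread-upper d S (W + W) S≤ v) (≤-trans (m≤m+n _ _) c≤)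
  enough-W : ∀ {k} → capacity (suc d) W ≤ k → W ≤ k
  enough-W c≤ = ≤-trans (m≤m+n W W) (≤-trans (m≤m+n _ _) c≤)
  la₀-split : ∀ v → length (la₀ v) ≡ p v + length (drop (p v) (la₀ v))
  la₀-split v = length-split (p v) (la₀ v) (enough-p v (ca _))
  la₁-split : ∀ v → length (la₁ v) ≡ W + length (drop W (la₁ v))
  la₁-split v = length-split W (la₁ v) (enough-W (ca _))
  lb₀-split : ∀ v → length (lb₀ v) ≡ W + length (drop W (lb₀ v))
  lb₀-split v = length-split W (lb₀ v) (enough-W (cb _))
  lb₁-split : ∀ v → length (lb₁ v) ≡ p v + length (drop (p v) (lb₁ v))
  lb₁-split v = length-split (p v) (lb₁ v) (enough-p v (cb _))

  total-split-p : ∀ (l : Cube d → List X) → (∀ v → length (l v) ≡ p v + length (drop (p v) (l v))) →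
    total (length ∘ l) ≡ S + total (λ v → length (drop (p v) (l v)))
  total-split-p l split = trans (total-cong split) (trans (total-+ p (λ v → length (drop (p v) (l v)))) (cong (_+ total (λ v → length (drop (p v) (l v)))) (total-spread d S)))
  total-split-W : ∀ (l : Cube d → List X) → (∀ v → length (l v) ≡ W + length (drop W (l v))) →
    total (length ∘ l) ≡ V + total (λ v → length (drop W (l v)))
  total-split-W l split = trans (total-cong split) (trans (total-+ (λ _ → W) (λ v → length (drop W (l v)))) (cong (_+ total (λ v → length (drop W (l v)))) (total-const d W)))

  a₀ = total (λ v → length (drop (p v) (la₀ v)))
  b₀ = total (λ v → length (drop W (lb₀ v)))
  a₁ = total (λ v → length (drop W (la₁ v)))
  b₁ = total (λ v → length (drop (p v) (lb₁ v)))

  eq₀ : a₀ ≡ b₀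
  eq₀ = +-cancelˡ-≡ (S + V) _ _ (begin
    (S + V) + a₀ ≡⟨ lem S V a₀ ⟩
    (S + a₀) + V ≡⟨ cong (_+ V) (total-split-p la₀ la₀-split) ⟨
    A₀ + V ≡⟨ S+B₀ ⟨
    S + B₀ ≡⟨ cong (S +_) (total-split-W lb₀ lb₀-split) ⟩
    S + (V + b₀) ≡⟨ +-assoc S V b₀ ⟨
    (S + V) + b₀ ∎)
    where
    open ≡-Reasoning
    lem : ∀ x y z → (x + y) + z ≡ (x + z) + y
    lem = solve-∀
  eq₁ : a₁ ≡ b₁
  eq₁ = +-cancelˡ-≡ (A₀ + V) _ _ (begin
    (A₀ + V) + a₁ ≡⟨ +-assoc A₀ V a₁ ⟩
    A₀ + (V + a₁) ≡⟨ cong (A₀ +_) (total-split-W la₁ la₁-split) ⟨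
    A₀ + A₁ ≡⟨ eq ⟩
    B₀ + B₁ ≡⟨ cong (B₀ +_) (total-split-p lb₁ lb₁-split) ⟩
    B₀ + (S + b₁) ≡⟨ lem B₀ S b₁ ⟩
    (S + B₀) + b₁ ≡⟨ cong (_+ b₁) S+B₀ ⟩
    (A₀ + V) + b₁ ∎)
    where
    open ≡-Reasoning
    lem : ∀ x y z → x + (y + z) ≡ (y + x) + z
    lem = solve-∀

  -- `P` and `Q` count the points removed on the left and on the right of the oscillation
  -- inequality. They differ only through two shares of `spread`, hence `Q ≤ suc P`.
  osc-step : ∀ P Q a b a′ b′ → P + (a + b′) ≤ Q + (a′ + b + W) → Q ≤ suc P → a + b′ ≤ a′ + b + suc W
  osc-step P Q a b a′ b′ h Q≤ = +-cancelˡ-≤ P _ _ (≤-trans h (≤-trans (+-monoˡ-≤ _ Q≤) (≤-reflexive (lem P (a′ + b) W))))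
    where
    lem : ∀ x y z → suc x + (y + z) ≡ x + (y + suc z)
    lem = solve-∀

  across₀₁ : Matching R T₀ U₁
  across₀₁ = match-gather _ _ (λ v → match-zip _ _
    (trans (length-take (p v) (la₀ v)) (trans (m≤n⇒m⊓n≡m (enough-p v (ca _)))
      (sym (trans (length-take (p v) (lb₁ v)) (m≤n⇒m⊓n≡m (enough-p v (cb _)))))))
    (λ x∈ y∈ → r (false ∷ v) (true ∷ v) (≤-reflexive (cong suc (dist-refl v)))
      (∈-take (p v) (la₀ v) x∈) (∈-take (p v) (lb₁ v) y∈)))
  across₁₀ : Matching R T₁ U₀
  across₁₀ = match-gather _ _ (λ v → match-zip _ _
    (trans (length-take W (la₁ v)) (trans (m≤n⇒m⊓n≡m (enough-W (ca _)))
      (sym (trans (length-take W (lb₀ v)) (m≤n⇒m⊓n≡m (enough-W (cb _)))))))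
    (λ x∈ y∈ → r (true ∷ v) (false ∷ v) (≤-reflexive (cong suc (dist-refl v)))
      (∈-take W (la₁ v) x∈) (∈-take W (lb₀ v) y∈)))

  left-over-p : ∀ {k m} v → capacity (suc d) W ≤ k → k ≡ p v + m → capacity d (suc W) ≤ m
  left-over-p v c≤ refl = +-cancelˡ-≤ (p v) _ _
    (≤-trans (+-monoˡ-≤ _ (spread-upper d S (W + W) S≤ v)) c≤)
  left-over-W : ∀ {k m} → capacity (suc d) W ≤ k → k ≡ W + m → capacity d (suc W) ≤ m
  left-over-W c≤ refl = +-cancelˡ-≤ W _ _ (≤-trans (+-monoˡ-≤ _ (m≤m+n W W)) c≤)

  within₀ : Matching R (gather (λ v → drop (p v) (la₀ v))) (gather (λ v → drop W (lb₀ v)))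
  within₀ = flow d _ _ (suc W) eq₀
    (λ v w → osc-step (p v + W) (p w + W) (length (drop (p v) (la₀ v))) (length (drop W (lb₀ v)))
      (length (drop (p w) (la₀ w))) (length (drop W (lb₀ w)))
      (subst₂ _≤_
        (trans (cong₂ _+_ (la₀-split v) (lb₀-split w)) (+-interchange (p v) _ W _))
        (trans (cong (_+ W) (cong₂ _+_ (la₀-split w) (lb₀-split v)))
          (trans (cong (_+ W) (+-interchange (p w) _ W _)) (+-assoc (p w + W) _ W)))
        (osc (false ∷ v) (false ∷ w)))
      (+-monoˡ-≤ W (spread-even d S w v)))
    (λ v → left-over-p v (ca _) (la₀-split v)) (λ v → left-over-W (cb _) (lb₀-split v))
    (λ v w vw x∈ y∈ → r (false ∷ v) (false ∷ w) vw (∈-drop (p v) (la₀ v) x∈) (∈-drop W (lb₀ w) y∈))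
  within₁ : Matching R (gather (λ v → drop W (la₁ v))) (gather (λ v → drop (p v) (lb₁ v)))
  within₁ = flow d _ _ (suc W) eq₁
    (λ v w → osc-step (W + p w) (W + p v) (length (drop W (la₁ v))) (length (drop (p v) (lb₁ v)))
      (length (drop W (la₁ w))) (length (drop (p w) (lb₁ w)))
      (subst₂ _≤_
        (trans (cong₂ _+_ (la₁-split v) (lb₁-split w)) (+-interchange W _ (p w) _))
        (trans (cong (_+ W) (cong₂ _+_ (la₁-split w) (lb₁-split v)))
          (trans (cong (_+ W) (+-interchange W _ (p v) _)) (+-assoc (W + p v) _ W)))
        (osc (true ∷ v) (true ∷ w)))
      (≤-trans (+-monoʳ-≤ W (spread-even d S v w)) (≤-reflexive (+-suc W (p w)))))
    (λ v → left-over-W (ca _) (la₁-split v)) (λ v → left-over-p v (cb _) (lb₁-split v))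
    (λ v w vw x∈ y∈ → r (true ∷ v) (true ∷ w) vw (∈-drop W (la₁ v) x∈) (∈-drop (p w) (lb₁ w) y∈))

capacity-bound : ∀ d W → capacity d W ≤ d * (2 * (W + d))
capacity-bound zero W = z≤n
capacity-bound (suc d) W = begin
  (W + W) + capacity d (suc W)        ≤⟨ +-monoʳ-≤ (W + W) (capacity-bound d (suc W)) ⟩
  (W + W) + d * (2 * (suc W + d))     ≤⟨ m≤m+n _ (2 * suc d) ⟩
  (W + W) + d * (2 * (suc W + d)) + 2 * suc d ≡⟨ lem W d ⟩
  suc d * (2 * (W + suc d)) ∎
  where
  open ≤-Reasoning
  lem : ∀ W d → (W + W) + d * (2 * (suc W + d)) + 2 * suc d ≡ suc d * (2 * (W + suc d))
  lem = solve-∀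

-- From a matching to a bijection

Unique-resp-↭ : ∀ {X : Set} {xs ys : List X} → xs ↭ ys → Unique xs → Unique ys
Unique-resp-↭ {X} p = ↭ₛ.Unique-resp-↭ (setoid X) (↭⇒↭ₛ p)

∈-allCube : ∀ {n} (x : Cube n) → x ∈ allCube n
∈-allCube [] = here refl
∈-allCube (false ∷ x) = ∈-++⁺ˡ (∈-map⁺ (false ∷_) (∈-allCube x))
∈-allCube {suc n} (true ∷ x) = ∈-++⁺ʳ (map (false ∷_) (allCube n)) (∈-map⁺ (true ∷_) (∈-allCube x))

allCube-unique : ∀ n → Unique (allCube n)
allCube-unique zero = [] ∷ []
allCube-unique (suc n) = Unique.++⁺ (Unique.map⁺ ∷-injectiveʳ (allCube-unique n))
  (Unique.map⁺ ∷-injectiveʳ (allCube-unique n))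
  λ (p , q) → head-differs (proj₂ (proj₂ (∈-map⁻ (false ∷_) p))) (proj₂ (proj₂ (∈-map⁻ (true ∷_) q)))
  where
  head-differs : ∀ {x : Cube (suc n)} {y z} → x ≡ false ∷ y → ¬ x ≡ true ∷ z
  head-differs refl ()

module _ {X : Set} (_≟X_ : DecidableEquality X) where

  -- The first pair containing `z` decides. When the two columns are duplicate-free and disjoint,
  -- `z` lies in at most one pair, so this is the product of disjoint transpositions.
  exchange : List (X × X) → X → X
  exchange [] z = z
  exchange ((x , y) ∷ ps) z with z ≟X x
  ... | yes _ = y
  ... | no _ with z ≟X y
  ...   | yes _ = x
  ...   | no _ = exchange ps z

  data Exchanged (ps : List (X × X)) (z w : X) : Set where
    fixed : w ≡ z → ¬ z ∈ map proj₁ ps → ¬ z ∈ map proj₂ ps → Exchanged ps z w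
    left  : (z , w) ∈ ps → Exchanged ps z w
    right : (w , z) ∈ ps → Exchanged ps z w

  exchanged : ∀ ps z → Exchanged ps z (exchange ps z)
  exchanged [] z = fixed refl (λ ()) (λ ())
  exchanged ((x , y) ∷ ps) z with z ≟X x
  ... | yes refl = left (here refl)
  ... | no z≢x with z ≟X y
  ...   | yes refl = right (here refl)
  ...   | no z≢y with exchanged ps z
  ...     | fixed e z∉ z∉′ = fixed e (λ { (here p) → z≢x p ; (there p) → z∉ p })
                                     (λ { (here p) → z≢y p ; (there p) → z∉′ p })
  ...     | left p = left (there p)
  ...     | right p = right (there p)

  Separated : List (X × X) → Set
  Separated ps = ∀ {x} → x ∈ map proj₁ ps → ¬ x ∈ map proj₂ ps

  exchange-left : ∀ ps → Unique (map proj₁ ps) → Separated ps → ∀ {z w} → (z , w) ∈ ps → exchange ps z ≡ w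
  exchange-left ((x , y) ∷ ps) (x∉ ∷ u) sep {z} zw∈ with z ≟X x
  exchange-left ((x , y) ∷ ps) (x∉ ∷ u) sep (here refl) | yes refl = refl
  exchange-left ((x , y) ∷ ps) (x∉ ∷ u) sep (there zw∈) | yes refl =
    ⊥-elim (All.lookup x∉ (∈-map⁺ proj₁ zw∈) refl)
  exchange-left ((x , y) ∷ ps) (x∉ ∷ u) sep (here refl) | no z≢x = ⊥-elim (z≢x refl)
  exchange-left ((x , y) ∷ ps) (x∉ ∷ u) sep {z} (there zw∈) | no z≢x with z ≟X y
  ... | yes refl = ⊥-elim (sep (there (∈-map⁺ proj₁ zw∈)) (here refl))
  ... | no _ = exchange-left ps u (λ p q → sep (there p) (there q)) zw∈

  exchange-right : ∀ ps → Unique (map proj₂ ps) → Separated ps → ∀ {z w} → (w , z) ∈ ps → exchange ps z ≡ w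
  exchange-right ((x , y) ∷ ps) (y∉ ∷ u) sep {z} wz∈ with z ≟X x
  ... | yes refl = ⊥-elim (sep (here refl) (∈-map⁺ proj₂ wz∈))
  ... | no _ with z ≟X y
  exchange-right ((x , y) ∷ ps) (y∉ ∷ u) sep (here refl) | no _ | yes _ = refl
  exchange-right ((x , y) ∷ ps) (y∉ ∷ u) sep (there wz∈) | no _ | yes refl =
    ⊥-elim (All.lookup y∉ (∈-map⁺ proj₂ wz∈) refl)
  exchange-right ((x , y) ∷ ps) (y∉ ∷ u) sep (here refl) | no _ | no z≢y = ⊥-elim (z≢y refl)
  exchange-right ((x , y) ∷ ps) (y∉ ∷ u) sep (there wz∈) | no _ | no _ =
    exchange-right ps u (λ p q → sep (there p) (there q)) wz∈

  exchange-involutive : ∀ ps → Unique (map proj₁ ps) → Unique (map proj₂ ps) → Separated ps →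
    ∀ z → exchange ps (exchange ps z) ≡ z
  exchange-involutive ps ul ur sep z with exchanged ps z
  ... | fixed e _ _ = trans (cong (exchange ps) e) e
  ... | left p = exchange-right ps ur sep p
  ... | right p = exchange-left ps ul sep p

fibre : ∀ {n} → (Cube (suc n) → Bool) → Bool → Bool → List (Cube (suc n))
fibre {n} f c b = filter (λ x → f x ≟ b) (map (c ∷_) (allCube n))

fibre-unique : ∀ {n} (f : Cube (suc n) → Bool) c b → Unique (fibre f c b)
fibre-unique {n} f c b = Unique.filter⁺ _ (Unique.map⁺ ∷-injectiveʳ (allCube-unique n))

∈-fibre⁻ : ∀ {n} (f : Cube (suc n) → Bool) c b {x} → x ∈ fibre f c b → head x ≡ c × f x ≡ b
∈-fibre⁻ f c b x∈ with ∈-filter⁻ (λ x → f x ≟ b) {xs = map (c ∷_) (allCube _)} x∈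
... | x∈map , fx with ∈-map⁻ (c ∷_) x∈map
... | _ , _ , refl = refl , fx

∈-fibre⁺ : ∀ {n} (f : Cube (suc n) → Bool) c b {x} → head x ≡ c → f x ≡ b → x ∈ fibre f c b
∈-fibre⁺ f c b {x = _ ∷ x} refl fx = ∈-filter⁺ (λ x → f x ≟ b) (∈-map⁺ (c ∷_) (∈-allCube x)) fx

matching⇒Good : ∀ {n} C (f : Cube (suc n) → Bool) →
  Matching (λ x y → dist x y ≤ C) (fibre f true false) (fibre f false true) → Good C f
matching⇒Good {n} C f (matching ps ls rs near) =
  mk↔ₛ′ φ φ involutive involutive , mapping , close , lipschitz , lipschitz
  where
  open ≤-Reasoning
  _≟C_ : DecidableEquality (Cube (suc n))
  _≟C_ = ≡-dec _≟_
  φ = exchange _≟C_ ps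
  left⁻ : ∀ {x} → x ∈ map proj₁ ps → head x ≡ true × f x ≡ false
  left⁻ = ∈-fibre⁻ f true false ∘ ∈-resp-↭ ls
  right⁻ : ∀ {x} → x ∈ map proj₂ ps → head x ≡ false × f x ≡ true
  right⁻ = ∈-fibre⁻ f false true ∘ ∈-resp-↭ rs
  separated : Separated _≟C_ ps
  separated p q with trans (sym (proj₁ (left⁻ p))) (proj₁ (right⁻ q))
  ... | ()
  involutive : ∀ z → φ (φ z) ≡ z
  involutive = exchange-involutive _≟C_ ps
    (Unique-resp-↭ (↭-sym ls) (fibre-unique f true false))
    (Unique-resp-↭ (↭-sym rs) (fibre-unique f false true)) separated
  -- The points in neither column are those where `f` and the first coordinate agree, so fixing them
  -- is correct.
  right-already : ∀ z → ¬ z ∈ map proj₁ ps → ¬ z ∈ map proj₂ ps → head z ≡ f z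
  right-already z z∉ z∉′ with head z in h | f z in e
  ... | true | true = refl
  ... | false | false = refl
  ... | true | false = ⊥-elim (z∉ (∈-resp-↭ (↭-sym ls) (∈-fibre⁺ f true false h e)))
  ... | false | true = ⊥-elim (z∉′ (∈-resp-↭ (↭-sym rs) (∈-fibre⁺ f false true h e)))
  mapping : ∀ z → head z ≡ f (φ z)
  mapping z with exchanged _≟C_ ps z
  ... | fixed e z∉ z∉′ = trans (right-already z z∉ z∉′) (cong f (sym e))
  ... | left p = trans (proj₁ (left⁻ (∈-map⁺ proj₁ p))) (sym (proj₂ (right⁻ (∈-map⁺ proj₂ p))))
  ... | right p = trans (proj₁ (right⁻ (∈-map⁺ proj₂ p))) (sym (proj₂ (left⁻ (∈-map⁺ proj₁ p))))
  close : ∀ z → dist z (φ z) ≤ C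
  close z with exchanged _≟C_ ps z
  ... | fixed e _ _ = ≤-trans (≤-reflexive (trans (cong (dist z) e) (dist-refl z))) z≤n
  ... | left p = All.lookup near p
  ... | right p = ≤-trans (≤-reflexive (dist-sym z (φ z))) (All.lookup near p)
  lipschitz : ∀ x y → dist (φ x) (φ y) ≤ (2 * C + 1) * dist x y
  lipschitz x y with dist x y in eq
  -- Coinciding points are treated apart: the displacement of the two ends adds `2 * C`, which is
  -- absorbed by the factor only if the distance is at least 1.
  ... | zero rewrite dist≡0⇒≡ x y eq = ≤-trans (≤-reflexive (dist-refl (φ y))) z≤n
  ... | suc d = begin
    dist (φ x) (φ y)                          ≤⟨ dist-triangle (φ x) x (φ y) ⟩
    dist (φ x) x + dist x (φ y)               ≤⟨ +-monoʳ-≤ (dist (φ x) x) (dist-triangle x y (φ y)) ⟩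
    dist (φ x) x + (dist x y + dist y (φ y))
      ≤⟨ +-mono-≤ (≤-trans (≤-reflexive (dist-sym (φ x) x)) (close x)) (+-mono-≤ (≤-reflexive eq) (close y)) ⟩
    C + (suc d + C)                           ≤⟨ m≤m+n _ (2 * C * d) ⟩
    C + (suc d + C) + 2 * C * d               ≡⟨ lem C d ⟩
    (2 * C + 1) * suc d ∎
    where
    lem : ∀ C d → C + (suc d + C) + 2 * C * d ≡ (2 * C + 1) * suc d
    lem = solve-∀

-- Splitting the cube into slabs

gather-filter : ∀ {X : Set} {P : X → Set} (P? : Decidable P) {d} (l : Cube d → List X) →
  gather (λ v → filter P? (l v)) ≡ filter P? (gather l)
gather-filter P? {zero} l = refl
gather-filter P? {suc d} l =
  trans (cong₂ _++_ (gather-filter P? (l ∘ (false ∷_))) (gather-filter P? (l ∘ (true ∷_))))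
        (sym (filter-++ P? (gather (l ∘ (false ∷_))) _))

gather-map : ∀ {X Y : Set} (g : X → Y) {d} (l : Cube d → List X) →
  gather (λ v → map g (l v)) ≡ map g (gather l)
gather-map g {zero} l = refl
gather-map g {suc d} l =
  trans (cong₂ _++_ (gather-map g (l ∘ (false ∷_))) (gather-map g (l ∘ (true ∷_))))
        (sym (map-++ g (gather (l ∘ (false ∷_))) _))

gather≡concatMap : ∀ {X : Set} {d} (l : Cube d → List X) → gather l ≡ concatMap l (allCube d)
gather≡concatMap {d = zero} l = sym (++-identityʳ (l []))
gather≡concatMap {d = suc d} l = trans
  (cong₂ _++_ (trans (gather≡concatMap (l ∘ (false ∷_))) (sym (concatMap-map l (false ∷_) (allCube d))))
              (trans (gather≡concatMap (l ∘ (true ∷_))) (sym (concatMap-map l (true ∷_) (allCube d)))))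
  (sym (concatMap-++ l (map (false ∷_) (allCube d)) _))

concatMap-cartesianProductWith : ∀ {X Y Z : Set} (g : X → Y → Z) xs ys →
  concatMap (λ x → map (g x) ys) xs ≡ cartesianProductWith g xs ys
concatMap-cartesianProductWith g [] ys = refl
concatMap-cartesianProductWith g (x ∷ xs) ys = cong (map (g x) ys ++_) (concatMap-cartesianProductWith g xs ys)

unique-complete-↭ : ∀ {n} {xs : List (Cube n)} → Unique xs → (∀ x → x ∈ xs) → xs ↭ allCube n
unique-complete-↭ {n} u complete =
  ∼bag⇒↭ (unique∧set⇒bag u (allCube-unique n) (mk⇔ (λ _ → ∈-allCube _) (λ _ → complete _)))

length-allCube : ∀ n → length (allCube n) ≡ 2 ^ n
length-allCube zero = refl
length-allCube (suc n) = trans (length-++ (map (false ∷_) (allCube n)))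
  (trans (cong₂ _+_ (trans (length-map _ (allCube n)) (length-allCube n))
                    (trans (length-map _ (allCube n)) (length-allCube n)))
         (cong (2 ^ n +_) (sym (+-identityʳ _))))

count : ∀ {X : Set} → (X → Bool) → Bool → List X → ℕ
count f b xs = length (filter (λ x → f x ≟ b) xs)

count-false-true : ∀ {X : Set} (f : X → Bool) xs → count f false xs + count f true xs ≡ length xs
count-false-true f [] = refl
count-false-true f (x ∷ xs) with f x
... | false = cong suc (count-false-true f xs)
... | true = trans (+-suc _ _) (cong suc (count-false-true f xs))

-- Balancedness says `F₀ + F₁ ≡ T₀ + T₁`, and the two halves of the cube having equal size says
-- `F₁ + T₁ ≡ F₀ + T₀`. Adding the two gives `2 * F₁ ≡ 2 * T₀`.
balanced⇒fibre : ∀ {n} (f : Cube (suc n) → Bool) → Balanced f →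
  length (fibre f true false) ≡ length (fibre f false true)
balanced⇒fibre {n} f bal = *-cancelˡ-≡ F₁ T₀ 2 (begin
  2 * F₁                ≡⟨ +-cancelʳ-≡ (F₀ + T₀) _ _ (begin
    2 * F₁ + (F₀ + T₀)     ≡⟨ lem₁ F₀ F₁ T₀ ⟩
    (F₀ + F₁) + (T₀ + F₁)  ≡⟨ cong (_+ (T₀ + F₁)) (trans (sym (halves false)) (trans bal (halves true))) ⟩
    (T₀ + T₁) + (T₀ + F₁)  ≡⟨ lem₂ T₀ T₁ F₁ ⟩
    2 * T₀ + (F₁ + T₁)     ≡⟨ cong (2 * T₀ +_) (trans (all true) (sym (all false))) ⟩
    2 * T₀ + (F₀ + T₀)     ∎) ⟩
  2 * T₀                ∎)
  where
  open ≡-Reasoning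
  F₀ = length (fibre f false false)
  F₁ = length (fibre f true false)
  T₀ = length (fibre f false true)
  T₁ = length (fibre f true true)
  halves : ∀ b → countVal f b ≡ length (fibre f false b) + length (fibre f true b)
  halves b = trans (cong length (filter-++ (λ x → f x ≟ b) (map (false ∷_) (allCube n)) _))
                   (length-++ (fibre f false b))
  all : ∀ c → length (fibre f c false) + length (fibre f c true) ≡ length (allCube n)
  all c = trans (count-false-true f (map (c ∷_) (allCube n))) (length-map _ (allCube n))
  lem₁ : ∀ x y z → 2 * y + (x + z) ≡ (x + y) + (z + y)
  lem₁ = solve-∀
  lem₂ : ∀ x y z → (x + y) + (x + z) ≡ 2 * x + (z + y)
  lem₂ = solve-∀

module _ {n d e α} (B : Blocks n d e α) where
  open Blocks B

  slab : Bool → Cube d → List (Cube (suc n))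
  slab c v = map (c ∷_) (map (point v) (allCube e))

  length-slab : ∀ c v → length (slab c v) ≡ 2 ^ e
  length-slab c v = trans (length-map (c ∷_) (map (point v) (allCube e)))
    (trans (length-map (point v) (allCube e)) (length-allCube e))

  point-injective : ∀ {v w a b} → point v a ≡ point w b → v ≡ w × a ≡ b
  point-injective {v} {w} {a} {b} eq =
    trans (sym (index-point v a)) (trans (cong index eq) (index-point w b)) ,
    trans (sym (label-point v a)) (trans (cong label eq) (label-point w b))

  points-↭ : gather (λ v → map (point v) (allCube e)) ↭ allCube n
  points-↭ = ↭-trans
    (↭-reflexive (trans (gather≡concatMap (λ v → map (point v) (allCube e)))
                        (concatMap-cartesianProductWith point (allCube d) (allCube e))))
    (unique-complete-↭
      (Unique.cartesianProductWith⁺ point point-injective (allCube-unique d) (allCube-unique e))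
      (λ x → subst (_∈ cartesianProductWith point (allCube d) (allCube e)) (point-index x)
        (∈-cartesianProductWith⁺ point (∈-allCube (index x)) (∈-allCube (label x)))))

  gather-slab : ∀ f c b → gather (λ v → filter (λ x → f x ≟ b) (slab c v)) ↭ fibre f c b
  gather-slab f c b = ↭-trans
    (↭-reflexive (trans (gather-filter (λ x → f x ≟ b) (slab c))
      (cong (filter (λ x → f x ≟ b)) (gather-map (c ∷_) (λ v → map (point v) (allCube e))))))
    (filter-↭ (λ x → f x ≟ b) (↭-map⁺ (c ∷_) points-↭))

  ∈-slab : ∀ {c v x} → x ∈ slab c v → Σ (Cube e) λ a → x ≡ c ∷ point v a
  ∈-slab x∈ with ∈-map⁻ _ x∈
  ... | _ , y∈ , refl with ∈-map⁻ _ y∈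
  ... | a , _ , refl = a , refl

  -- Upper bounds suffice: a slab has `h + h` points, so at most `h + M` of one value leaves at
  -- least `h - M` of the other. The oscillation `4 * M` compares two counts of at most `h + M` with
  -- two of at least `h - M`. The outer `suc` of the distance pays for the first coordinate, which
  -- separates the two families of slabs.
  tame⇒Good : ∀ {h M} → 2 ^ e ≡ h + h → capacity d (4 * M) + M ≤ h → (f : Cube (suc n) → Bool) → Balanced f →
    (∀ v c b → count f b (slab c v) ≤ h + M) → Good (suc (α + (3 + α))) f
  tame⇒Good {h} {M} 2^e cap≤ f bal tame = matching⇒Good _ f
    (match-↭ (gather-slab f true false) (gather-slab f false true)
      (flow d la lb (4 * M) equal osc (λ v → enough (lower-false true v)) (λ v → enough (lower-true false v)) near))
    where
    open ≤-Reasoning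
    la lb : Cube d → List (Cube (suc n))
    la v = filter (λ x → f x ≟ false) (slab true v)
    lb v = filter (λ x → f x ≟ true) (slab false v)
    equal : total (length ∘ la) ≡ total (length ∘ lb)
    equal = trans (sym (length-gather la)) (trans (↭-length (gather-slab f true false))
      (trans (balanced⇒fibre f bal)
      (trans (sym (↭-length (gather-slab f false true))) (length-gather lb))))
    both : ∀ c v → count f false (slab c v) + count f true (slab c v) ≡ h + h
    both c v = trans (count-false-true f (slab c v)) (trans (length-slab c v) 2^e)
    lower : ∀ x y → x + y ≡ h + h → y ≤ h + M → h ≤ x + M
    lower x y eq y≤ = +-cancelˡ-≤ h _ _ (begin
      h + h         ≡⟨ eq ⟨
      x + y         ≤⟨ +-monoʳ-≤ x y≤ ⟩
      x + (h + M)   ≡⟨ lem x h M ⟩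
      h + (x + M)   ∎)
      where
      lem : ∀ x y z → x + (y + z) ≡ y + (x + z)
      lem = solve-∀
    lower-false : ∀ c v → h ≤ count f false (slab c v) + M
    lower-false c v = lower _ _ (both c v) (tame v c true)
    lower-true : ∀ c v → h ≤ count f true (slab c v) + M
    lower-true c v = lower _ _ (trans (+-comm (count f true (slab c v)) _) (both c v)) (tame v c false)
    enough : ∀ {k} → h ≤ k + M → capacity d (4 * M) ≤ k
    enough h≤ = +-cancelʳ-≤ M _ _ (≤-trans cap≤ h≤)
    osc : ∀ v w → length (la v) + length (lb w) ≤ length (la w) + length (lb v) + 4 * M
    osc v w = begin
      length (la v) + length (lb w) ≤⟨ +-mono-≤ (tame v true false) (tame w false true) ⟩
      (h + M) + (h + M) ≤⟨ +-mono-≤ (+-monoˡ-≤ M (lower-false true w)) (+-monoˡ-≤ M (lower-true false v)) ⟩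
      (length (la w) + M + M) + (length (lb v) + M + M) ≡⟨ lem (length (la w)) (length (lb v)) M ⟩
      length (la w) + length (lb v) + 4 * M ∎
      where
      lem : ∀ x y m → (x + m + m) + (y + m + m) ≡ x + y + 4 * m
      lem = solve-∀
    near : ∀ v w → dist v w ≤ 1 → ∀ {x y} → x ∈ la v → y ∈ lb w → dist x y ≤ suc (α + (3 + α))
    near v w vw x∈ y∈
      with ∈-slab {true} {v} (proj₁ (∈-filter⁻ (λ x → f x ≟ false) {xs = slab true v} x∈))
         | ∈-slab {false} {w} (proj₁ (∈-filter⁻ (λ x → f x ≟ true) {xs = slab false w} y∈))
    ... | a , refl | b , refl = s≤s (dist-point v w a b vw)

-- Counting boolean functions and the tail bound

∑ ∏ : ∀ {X : Set} → List X → (X → ℕ) → ℕ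
∑ xs F = sum (map F xs)
∏ xs F = product (map F xs)

ind : ∀ {P : Set} → Dec P → ℕ
ind P? = if does P? then 1 else 0

module _ {X : Set} where

  ∑-cong : ∀ (xs : List X) {F G : X → ℕ} → (∀ x → F x ≡ G x) → ∑ xs F ≡ ∑ xs G
  ∑-cong xs F≡G = cong sum (map-cong F≡G xs)

  ∏-cong : ∀ (xs : List X) {F G : X → ℕ} → (∀ x → F x ≡ G x) → ∏ xs F ≡ ∏ xs G
  ∏-cong xs F≡G = cong product (map-cong F≡G xs)

  ∏-cong-∈ : ∀ (xs : List X) {F G : X → ℕ} → (∀ {x} → x ∈ xs → F x ≡ G x) → ∏ xs F ≡ ∏ xs G
  ∏-cong-∈ [] F≡G = refl
  ∏-cong-∈ (x ∷ xs) F≡G = cong₂ _*_ (F≡G (here refl)) (∏-cong-∈ xs (F≡G ∘ there))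

  ∑-mono : ∀ (xs : List X) {F G : X → ℕ} → (∀ x → F x ≤ G x) → ∑ xs F ≤ ∑ xs G
  ∑-mono [] F≤G = z≤n
  ∑-mono (x ∷ xs) F≤G = +-mono-≤ (F≤G x) (∑-mono xs F≤G)

  ∑-++ : ∀ (xs ys : List X) F → ∑ (xs ++ ys) F ≡ ∑ xs F + ∑ ys F
  ∑-++ xs ys F = trans (cong sum (map-++ F xs ys)) (sum-++ (map F xs) (map F ys))

  ∏-++ : ∀ (xs ys : List X) F → ∏ (xs ++ ys) F ≡ ∏ xs F * ∏ ys F
  ∏-++ xs ys F = trans (cong product (map-++ F xs ys)) (product-++ (map F xs) (map F ys))

  ∏-↭ : ∀ {xs ys : List X} F → xs ↭ ys → ∏ xs F ≡ ∏ ys F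
  ∏-↭ F p = product-↭ (↭-map⁺ F p)

  ∑-*ˡ : ∀ (xs : List X) c F → ∑ xs (λ x → c * F x) ≡ c * ∑ xs F
  ∑-*ˡ [] c F = sym (*-zeroʳ c)
  ∑-*ˡ (x ∷ xs) c F = trans (cong (c * F x +_) (∑-*ˡ xs c F)) (sym (*-distribˡ-+ c (F x) _))

  ∑-*ʳ : ∀ (xs : List X) c F → ∑ xs (λ x → F x * c) ≡ ∑ xs F * c
  ∑-*ʳ [] c F = refl
  ∑-*ʳ (x ∷ xs) c F = trans (cong (F x * c +_) (∑-*ʳ xs c F)) (sym (*-distribʳ-+ c (F x) _))

  ∑-+ : ∀ (xs : List X) F G → ∑ xs (λ x → F x + G x) ≡ ∑ xs F + ∑ xs G
  ∑-+ [] F G = refl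
  ∑-+ (x ∷ xs) F G = trans (cong (F x + G x +_) (∑-+ xs F G)) (+-interchange (F x) (G x) _ _)

  ∑-const : ∀ (xs : List X) c → ∑ xs (λ _ → c) ≡ length xs * c
  ∑-const [] c = refl
  ∑-const (x ∷ xs) c = cong (c +_) (∑-const xs c)

  ∏-const : ∀ (xs : List X) c → ∏ xs (λ _ → c) ≡ c ^ length xs
  ∏-const [] c = refl
  ∏-const (x ∷ xs) c = cong (c *_) (∏-const xs c)

  length-filter≡∑ : ∀ {P : X → Set} (P? : Decidable P) xs → length (filter P? xs) ≡ ∑ xs (λ x → ind (P? x))
  length-filter≡∑ P? [] = refl
  length-filter≡∑ P? (x ∷ xs) with P? x
  ... | yes _ = cong suc (length-filter≡∑ P? xs)
  ... | no _ = length-filter≡∑ P? xs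

  markov : ∀ {P : X → Set} (P? : Decidable P) xs c F → (∀ x → P x → c ≤ F x) →
    length (filter P? xs) * c ≤ ∑ xs F
  markov P? [] c F c≤F = z≤n
  markov P? (x ∷ xs) c F c≤F with P? x
  ... | yes p = +-mono-≤ (c≤F x p) (markov P? xs c F c≤F)
  ... | no _ = ≤-trans (markov P? xs c F c≤F) (m≤n+m _ _)

module _ {X Y : Set} where

  ∑-map : ∀ (k : X → Y) xs F → ∑ (map k xs) F ≡ ∑ xs (F ∘ k)
  ∑-map k xs F = cong sum (sym (map-∘ xs))

  ∏-map : ∀ (k : X → Y) xs F → ∏ (map k xs) F ≡ ∏ xs (F ∘ k)
  ∏-map k xs F = cong product (sym (map-∘ xs))

  ∑-concatMap : ∀ (k : X → List Y) xs F → ∑ (concatMap k xs) F ≡ ∑ xs (λ x → ∑ (k x) F)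
  ∑-concatMap k [] F = refl
  ∑-concatMap k (x ∷ xs) F = trans (∑-++ (k x) _ F) (cong (∑ (k x) F +_) (∑-concatMap k xs F))

  ∑-swap : ∀ (xs : List X) (ys : List Y) (F : X → Y → ℕ) → ∑ xs (λ x → ∑ ys (F x)) ≡ ∑ ys (λ y → ∑ xs (λ x → F x y))
  ∑-swap [] ys F = sym (trans (∑-const ys 0) (*-zeroʳ (length ys)))
  ∑-swap (x ∷ xs) ys F = trans (cong (∑ ys (F x) +_) (∑-swap xs ys F)) (sym (∑-+ ys (F x) (λ y → ∑ xs (λ x′ → F x′ y))))

  -- Markov's inequality with threshold 1, applied to the number of events that occur.
  union-bound : ∀ {P : Y → X → Set} (P? : ∀ y → Decidable (P y)) xs ys →
    length (filter (λ x → ¬? (All.all? (λ y → ¬? (P? y x)) ys)) xs) ≤ ∑ ys (λ y → length (filter (P? y) xs))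
  union-bound P? xs ys = begin
    length (filter none? xs)
      ≡⟨ *-identityʳ _ ⟨
    length (filter none? xs) * 1
      ≤⟨ markov none? xs 1 _ (λ x → some x ys) ⟩
    ∑ xs (λ x → ∑ ys (λ y → ind (P? y x)))
      ≡⟨ ∑-swap xs ys _ ⟩
    ∑ ys (λ y → ∑ xs (λ x → ind (P? y x)))
      ≡⟨ ∑-cong ys (λ y → length-filter≡∑ (P? y) xs) ⟨
    ∑ ys (λ y → length (filter (P? y) xs)) ∎
    where
    open ≤-Reasoning
    none? : Decidable (λ x → ¬ All (λ y → ¬ _) ys)
    none? x = ¬? (All.all? (λ y → ¬? (P? y x)) ys)
    some : ∀ x zs → ¬ All (λ y → ¬ _) zs → 1 ≤ ∑ zs (λ y → ind (P? y x))
    some x [] ¬all = ⊥-elim (¬all [])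
    some x (z ∷ zs) ¬all with P? z x
    ... | yes _ = s≤s z≤n
    ... | no ¬p = some x zs (λ all → ¬all (¬p ∷ all))

-- The gluing function in `allFun` is an anonymous pattern-matching lambda, so it is exposed here
-- through its values on the two halves and its summation rule.
allFun-suc : ∀ n → Σ ((Cube n → Bool) → (Cube n → Bool) → Cube (suc n) → Bool) λ glue →
  (∀ F → ∑ (allFun (suc n)) F ≡ ∑ (allFun n) (λ h → ∑ (allFun n) (λ g → F (glue h g)))) ×
  (∀ h g x → glue h g (false ∷ x) ≡ h x) × (∀ h g x → glue h g (true ∷ x) ≡ g x)
allFun-suc n = _ ,
  (λ F → trans (∑-concatMap _ (allFun n) F) (∑-cong (allFun n) (λ h → ∑-map _ (allFun n) F))) ,
  (λ h g x → refl) , (λ h g x → refl)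

-- Independence of the values of a uniform function: the expectation of a product over points is the
-- product of the expectations.
∑-allFun-∏ : ∀ n (w : Cube n → Bool → ℕ) →
  ∑ (allFun n) (λ f → ∏ (allCube n) (λ x → w x (f x))) ≡ ∏ (allCube n) (λ x → w x false + w x true)
∑-allFun-∏ zero w = lem (w [] false) (w [] true)
  where
  lem : ∀ a b → a * 1 + (b * 1 + 0) ≡ (a + b) * 1
  lem = solve-∀
∑-allFun-∏ (suc n) w with allFun-suc n
... | glue , ∑-glue , glue-false , glue-true = begin
  ∑ (allFun (suc n)) (λ f → ∏ (allCube (suc n)) (λ x → w x (f x)))
    ≡⟨ ∑-glue _ ⟩
  ∑ (allFun n) (λ h → ∑ (allFun n) (λ g → ∏ (allCube (suc n)) (λ x → w x (glue h g x))))
    ≡⟨ ∑-cong (allFun n) (λ h → ∑-cong (allFun n) (λ g → halves _)) ⟩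
  ∑ (allFun n) (λ h → ∑ (allFun n) (λ g →
    ∏ (allCube n) (λ x → w (false ∷ x) (glue h g (false ∷ x))) * ∏ (allCube n) (λ x → w (true ∷ x) (glue h g (true ∷ x)))))
    ≡⟨ ∑-cong (allFun n) (λ h → ∑-cong (allFun n) (λ g → cong₂ _*_
         (∏-cong (allCube n) (λ x → cong (w (false ∷ x)) (glue-false h g x)))
         (∏-cong (allCube n) (λ x → cong (w (true ∷ x)) (glue-true h g x))))) ⟩
  ∑ (allFun n) (λ h → ∑ (allFun n) (λ g → P false h * P true g))
    ≡⟨ ∑-cong (allFun n) (λ h → ∑-*ˡ (allFun n) (P false h) (P true)) ⟩
  ∑ (allFun n) (λ h → P false h * ∑ (allFun n) (P true))
    ≡⟨ ∑-*ʳ (allFun n) _ (P false) ⟩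
  ∑ (allFun n) (P false) * ∑ (allFun n) (P true)
    ≡⟨ cong₂ _*_ (∑-allFun-∏ n (w ∘ (false ∷_))) (∑-allFun-∏ n (w ∘ (true ∷_))) ⟩
  _ ≡⟨ halves _ ⟨
  ∏ (allCube (suc n)) (λ x → w x false + w x true) ∎
  where
  open ≡-Reasoning
  P : Bool → (Cube n → Bool) → ℕ
  P c f = ∏ (allCube n) (λ x → w (c ∷ x) (f x))
  halves : ∀ F → ∏ (allCube (suc n)) F ≡ ∏ (allCube n) (F ∘ (false ∷_)) * ∏ (allCube n) (F ∘ (true ∷_))
  halves F = trans (∏-++ (map (false ∷_) (allCube n)) _ F)
    (cong₂ _*_ (∏-map (false ∷_) (allCube n) F) (∏-map (true ∷_) (allCube n) F))

length-allFun : ∀ n → length (allFun n) ≡ ∏ (allCube n) (λ _ → 2)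
length-allFun n = begin
  length (allFun n)                                 ≡⟨ *-identityʳ _ ⟨
  length (allFun n) * 1                             ≡⟨ ∑-const (allFun n) 1 ⟨
  ∑ (allFun n) (λ _ → 1)                            ≡⟨ ∑-cong (allFun n) (λ _ → trans (∏-const (allCube n) 1) (^-zeroˡ (length (allCube n)))) ⟨
  ∑ (allFun n) (λ f → ∏ (allCube n) (λ x → 1))      ≡⟨ ∑-allFun-∏ n (λ _ _ → 1) ⟩
  ∏ (allCube n) (λ _ → 2) ∎
  where open ≡-Reasoning

module _ (q : ℕ) (b : Bool) where

  -- The exponential weight of Chernoff's method with base `(q + 1) / q`, multiplied by `q` to stay
  -- among natural numbers.
  weight : Bool → ℕ
  weight c = if does (c ≟ b) then suc q else q

  weight-sum : weight false + weight true ≡ suc (q + q)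
  weight-sum = cases b
    where
    cases : ∀ b → (if does (false ≟ b) then suc q else q) + (if does (true ≟ b) then suc q else q) ≡ suc (q + q)
    cases false = refl
    cases true = +-suc q q

  -- A point with value `b` beyond the first `t` has its factor `suc q` replaced by `q`, which can
  -- only lower the product.
  ∏-weight-lower : ∀ {X : Set} (f : X → Bool) S t t′ → t + t′ ≡ length S → t ≤ count f b S →
    suc q ^ t * q ^ t′ ≤ ∏ S (λ x → weight (f x))
  ∏-weight-lower f [] zero zero eq t≤ = ≤-refl
  ∏-weight-lower f (x ∷ S) t t′ eq t≤ with f x ≟ b
  ∏-weight-lower f (x ∷ S) zero (suc t′) eq t≤ | yes _ =
    ≤-trans (≤-reflexive (lem q (q ^ t′)))
      (*-mono-≤ (n≤1+n q) (∏-weight-lower f S zero t′ (suc-injective eq) z≤n))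
    where
    lem : ∀ x y → 1 * (x * y) ≡ x * (1 * y)
    lem = solve-∀
  ∏-weight-lower f (x ∷ S) (suc t) t′ eq (s≤s t≤) | yes _ =
    ≤-trans (≤-reflexive (*-assoc (suc q) (suc q ^ t) _))
      (*-monoʳ-≤ (suc q) (∏-weight-lower f S t t′ (suc-injective eq) t≤))
  ∏-weight-lower f (x ∷ S) t zero eq t≤ | no _ =
    ⊥-elim (<-irrefl refl (≤-trans (≤-reflexive (trans (sym eq) (+-identityʳ t)))
      (≤-trans t≤ (length-filter (λ x → f x ≟ b) S))))
  ∏-weight-lower f (x ∷ S) t (suc t′) eq t≤ | no _ =
    ≤-trans (≤-reflexive (lem (suc q ^ t) q (q ^ t′)))
      (*-monoʳ-≤ q (∏-weight-lower f S t t′ (suc-injective (trans (sym (+-suc t t′)) eq)) t≤))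
    where
    lem : ∀ x y z → x * (y * z) ≡ y * (x * z)
    lem = solve-∀

  module _ {n : ℕ} (S : List (Cube n)) (S-unique : Unique S) where

    open import Data.List.Membership.DecPropositional (≡-dec {n = n} _≟_) using (_∈?_)

    rest : List (Cube n)
    rest = filter (λ x → ¬? (x ∈? S)) (allCube n)

    rest-disjoint : ∀ {x} → x ∈ rest → ¬ x ∈ S
    rest-disjoint x∈ = proj₂ (∈-filter⁻ (λ x → ¬? (x ∈? S)) {xs = allCube n} x∈)

    S++rest : allCube n ↭ S ++ rest
    S++rest = ↭-sym (unique-complete-↭
      (Unique.++⁺ S-unique (Unique.filter⁺ _ (allCube-unique n)) (λ (p , q) → rest-disjoint q p)) complete)
      where
      complete : ∀ x → x ∈ S ++ rest
      complete x with x ∈? S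
      ... | yes x∈ = ∈-++⁺ˡ x∈
      ... | no x∉ = ∈-++⁺ʳ S (∈-filter⁺ (λ x → ¬? (x ∈? S)) (∈-allCube x) x∉)

    -- Weight 1 outside `S` turns a product over `S` into one over the whole cube, the form to which
    -- `∑-allFun-∏` applies.
    masked : Cube n → Bool → ℕ
    masked x c = if does (x ∈? S) then weight c else 1

    masked-inside : ∀ {x} c → x ∈ S → masked x c ≡ weight c
    masked-inside {x} c x∈ with x ∈? S
    ... | yes _ = refl
    ... | no x∉ = ⊥-elim (x∉ x∈)

    masked-outside : ∀ {x} c → x ∈ rest → masked x c ≡ 1
    masked-outside {x} c x∈ with x ∈? S
    ... | yes x∈S = ⊥-elim (rest-disjoint x∈ x∈S)
    ... | no _ = refl

    ∏-masked : ∀ (f : Cube n → Bool) → ∏ (allCube n) (λ x → masked x (f x)) ≡ ∏ S (λ x → weight (f x))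
    ∏-masked f = begin
      ∏ (allCube n) (λ x → masked x (f x))
        ≡⟨ trans (∏-↭ _ S++rest) (∏-++ S rest _) ⟩
      ∏ S (λ x → masked x (f x)) * ∏ rest (λ x → masked x (f x))
        ≡⟨ cong₂ _*_ (∏-cong-∈ S (λ {x} x∈ → masked-inside (f x) x∈)) (∏-cong-∈ rest (λ {x} x∈ → masked-outside (f x) x∈)) ⟩
      ∏ S (λ x → weight (f x)) * ∏ rest (λ _ → 1)
        ≡⟨ cong (∏ S (λ x → weight (f x)) *_) (trans (∏-const rest 1) (^-zeroˡ (length rest))) ⟩
      ∏ S (λ x → weight (f x)) * 1
        ≡⟨ *-identityʳ _ ⟩
      ∏ S (λ x → weight (f x)) ∎
      where open ≡-Reasoning

    ∏-masked-sum : ∏ (allCube n) (λ x → masked x false + masked x true) ≡ suc (q + q) ^ length S * 2 ^ length rest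
    ∏-masked-sum = begin
      ∏ (allCube n) (λ x → masked x false + masked x true)
        ≡⟨ trans (∏-↭ _ S++rest) (∏-++ S rest _) ⟩
      ∏ S (λ x → masked x false + masked x true) * ∏ rest (λ x → masked x false + masked x true)
        ≡⟨ cong₂ _*_ (∏-cong-∈ S (λ x∈ → trans (cong₂ _+_ (masked-inside false x∈) (masked-inside true x∈)) weight-sum))
                     (∏-cong-∈ rest (λ x∈ → cong₂ _+_ (masked-outside false x∈) (masked-outside true x∈))) ⟩
      ∏ S (λ _ → suc (q + q)) * ∏ rest (λ _ → 2)
        ≡⟨ cong₂ _*_ (∏-const S _) (∏-const rest 2) ⟩
      suc (q + q) ^ length S * 2 ^ length rest ∎
      where open ≡-Reasoning

    length-allFun-split : length (allFun n) ≡ 2 ^ length S * 2 ^ length rest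
    length-allFun-split = trans (length-allFun n) (trans (trans (∏-↭ _ S++rest) (∏-++ S rest _))
      (cong₂ _*_ (∏-const S 2) (∏-const rest 2)))

    -- Markov's inequality for the product of the weights. The factor `2 ^ length S` clears the
    -- denominator of the mean weight `(2q + 1) / 2` of a point.
    chernoff : ∀ t t′ → t + t′ ≡ length S →
      length (filter (λ f → t ≤? count f b S) (allFun n)) * (suc q ^ t * q ^ t′) * 2 ^ length S
        ≤ suc (q + q) ^ length S * length (allFun n)
    chernoff t t′ eq = begin
      length (filter (λ f → t ≤? count f b S) (allFun n)) * (suc q ^ t * q ^ t′) * 2 ^ length S
        ≤⟨ *-monoˡ-≤ (2 ^ length S) (markov (λ f → t ≤? count f b S) (allFun n) _ (λ f → ∏ (allCube n) (λ x → masked x (f x)))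
             (λ f t≤ → ≤-trans (∏-weight-lower f S t t′ eq t≤) (≤-reflexive (sym (∏-masked f))))) ⟩
      ∑ (allFun n) (λ f → ∏ (allCube n) (λ x → masked x (f x))) * 2 ^ length S
        ≡⟨ cong (_* 2 ^ length S) (trans (∑-allFun-∏ n masked) ∏-masked-sum) ⟩
      suc (q + q) ^ length S * 2 ^ length rest * 2 ^ length S
        ≡⟨ lem (suc (q + q) ^ length S) (2 ^ length rest) (2 ^ length S) ⟩
      suc (q + q) ^ length S * (2 ^ length S * 2 ^ length rest)
        ≡⟨ cong (suc (q + q) ^ length S *_) length-allFun-split ⟨
      suc (q + q) ^ length S * length (allFun n) ∎
      where
      open ≤-Reasoning
      lem : ∀ x y z → x * y * z ≡ x * (z * y)
      lem = solve-∀

-- Bernoulli's inequality with denominators cleared, and the tail estimate.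

bernoulli : ∀ q m → (q + m) * q ^ m ≤ q * suc q ^ m
bernoulli q zero = ≤-reflexive (lem q)
  where
  lem : ∀ q → (q + 0) * 1 ≡ q * 1
  lem = solve-∀
bernoulli q (suc m) = begin
  (q + suc m) * (q * q ^ m)              ≤⟨ m≤m+n _ (m * q ^ m) ⟩
  (q + suc m) * (q * q ^ m) + m * q ^ m  ≡⟨ lem q m (q ^ m) ⟩
  suc q * ((q + m) * q ^ m)              ≤⟨ *-monoʳ-≤ (suc q) (bernoulli q m) ⟩
  suc q * (q * suc q ^ m)                ≡⟨ lem′ q (suc q) (suc q ^ m) ⟩
  q * (suc q * suc q ^ m) ∎
  where
  open ≤-Reasoning
  lem : ∀ q m x → (q + suc m) * (q * x) + m * x ≡ suc q * ((q + m) * x)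
  lem = solve-∀
  lem′ : ∀ x y z → y * (x * z) ≡ x * (y * z)
  lem′ = solve-∀

-- Division by the power of `suc y` on the left shows the inequality `(1 - 1/(y+1))ᵐ ≥ 1 - m/(y+1)`,
-- with the subtracted term moved to the other side.
bernoulli⁻ : ∀ y m → suc y * suc y ^ m ≤ suc y * y ^ m + m * suc y ^ m
bernoulli⁻ y zero = m≤m+n _ _
bernoulli⁻ y (suc m) = begin
  suc y * (suc y * suc y ^ m)                     ≤⟨ *-monoʳ-≤ (suc y) (bernoulli⁻ y m) ⟩
  suc y * (suc y * y ^ m + m * suc y ^ m)         ≡⟨ lem y m (y ^ m) (suc y ^ m) ⟩
  suc y * (y * y ^ m) + (suc y * y ^ m + m * (suc y * suc y ^ m))
    ≤⟨ +-monoʳ-≤ (suc y * (y * y ^ m)) (+-monoˡ-≤ (m * (suc y * suc y ^ m)) (*-monoʳ-≤ (suc y) (^-monoˡ-≤ m (n≤1+n y)))) ⟩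
  suc y * (y * y ^ m) + (suc y * suc y ^ m + m * (suc y * suc y ^ m)) ∎
  where
  open ≤-Reasoning
  lem : ∀ y m a b → suc y * (suc y * a + m * b) ≡ suc y * (y * a) + (suc y * a + m * (suc y * b))
  lem = solve-∀

doubles : ∀ q .{{_ : NonZero q}} → 2 * q ^ q ≤ suc q ^ q
doubles q = *-cancelˡ-≤ q (≤-trans (≤-reflexive (lem q (q ^ q))) (bernoulli q q))
  where
  lem : ∀ q x → q * (2 * x) ≡ (q + q) * x
  lem = solve-∀

at-most-doubles : ∀ y m → 2 * m ≤ suc y → suc y ^ m ≤ 2 * y ^ m
at-most-doubles y m 2m≤ = *-cancelˡ-≤ (suc y) (+-cancelʳ-≤ (suc y * suc y ^ m) _ _ (begin
  suc y * suc y ^ m + suc y * suc y ^ m        ≤⟨ +-mono-≤ (bernoulli⁻ y m) (bernoulli⁻ y m) ⟩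
  (suc y * y ^ m + m * suc y ^ m) + (suc y * y ^ m + m * suc y ^ m) ≡⟨ lem (suc y) m (y ^ m) (suc y ^ m) ⟩
  suc y * (2 * y ^ m) + 2 * m * suc y ^ m      ≤⟨ +-monoʳ-≤ _ (*-monoˡ-≤ (suc y ^ m) 2m≤) ⟩
  suc y * (2 * y ^ m) + suc y * suc y ^ m ∎))
  where
  open ≤-Reasoning
  lem : ∀ c m a b → (c * a + m * b) + (c * a + m * b) ≡ c * (2 * a) + 2 * m * b
  lem = solve-∀

^-distribʳ-* : ∀ a b k → (a * b) ^ k ≡ a ^ k * b ^ k
^-distribʳ-* a b zero = refl
^-distribʳ-* a b (suc k) = trans (cong (a * b *_) (^-distribʳ-* a b k)) (lem a b (a ^ k) (b ^ k))
  where
  lem : ∀ a b x y → a * b * (x * y) ≡ a * x * (b * y)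
  lem = solve-∀

-- With y = 4q(q+1) one has (2q+1)² = y + 1, and h = 2q²s is small enough for ((y+1)/y)ʰ ≤ 2ˢ,
-- while a deviation of M = 2qs gains ((q+1)/q)ᴹ ≥ 2²ˢ.
tail-bound : ∀ {n} (S : List (Cube n)) → Unique S → ∀ b q s t .{{_ : NonZero q}} →
  let h = 2 * q * q * s; M = q * (2 * s) in
  length S ≡ h + h → M + t ≡ h →
  length (filter (λ f → h + M ≤? count f b S) (allFun n)) * 2 ^ s ≤ length (allFun n)
tail-bound {n} S S-unique b q s t |S| M+t = *-cancelˡ-≤ K {{K≢0}} (begin
  -- The weight bound of `chernoff` times `2 ^ length S` is `(q+1)^(h+M) * q^(h-M) * 4ʰ`, that is
  -- `yʰ * ((q+1)/q)ᴹ`. The factor `K` clears the denominators of this and of the two comparisons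
  -- with powers of 2, and is cancelled at the end.
  K * (X * 2 ^ s)
    ≡⟨ lem₁ (2 ^ s) (q ^ M) (y ^ h) X ⟩
  X * (2 ^ s * 2 ^ s * q ^ M * y ^ h)
    ≤⟨ *-monoʳ-≤ X (*-monoˡ-≤ (y ^ h) gain) ⟩
  X * (suc q ^ M * y ^ h)
    ≡⟨ cong (λ z → X * (suc q ^ M * z)) y^h ⟩
  X * (suc q ^ M * (2 ^ h * 2 ^ h * (q ^ h * suc q ^ h)))
    ≡⟨ cong (λ z → X * (suc q ^ M * (2 ^ h * 2 ^ h * (z * suc q ^ h)))) (trans (cong (q ^_) (sym M+t)) (^-distribˡ-+-* q M t)) ⟩
  X * (suc q ^ M * (2 ^ h * 2 ^ h * ((q ^ M * q ^ t) * suc q ^ h)))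
    ≡⟨ lem₂ X (suc q ^ M) (2 ^ h) (q ^ M) (q ^ t) (suc q ^ h) ⟩
  q ^ M * (X * ((suc q ^ h * suc q ^ M) * q ^ t) * (2 ^ h * 2 ^ h))
    ≡⟨ cong₂ (λ u v → q ^ M * (X * (u * q ^ t) * v)) (sym (^-distribˡ-+-* (suc q) h M))
         (trans (sym (^-distribˡ-+-* 2 h h)) (cong (2 ^_) (sym |S|))) ⟩
  q ^ M * (X * (suc q ^ (h + M) * q ^ t) * 2 ^ length S)
    ≤⟨ *-monoʳ-≤ (q ^ M) (chernoff q b S S-unique (h + M) t
         (trans (+-assoc h M t) (trans (cong (h +_) M+t) (sym |S|)))) ⟩
  q ^ M * (suc (q + q) ^ length S * G)
    ≡⟨ cong (λ z → q ^ M * (z * G)) odd^ ⟩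
  q ^ M * (suc y ^ h * G)
    ≤⟨ *-monoʳ-≤ (q ^ M) (*-monoˡ-≤ G loss) ⟩
  q ^ M * (2 ^ s * y ^ h * G)
    ≡⟨ lem₃ (q ^ M) (2 ^ s) (y ^ h) G ⟩
  K * G ∎)
  where
  open ≤-Reasoning
  h = 2 * q * q * s
  M = q * (2 * s)
  y = 2 * 2 * (q * suc q)
  X = length (filter (λ f → h + M ≤? count f b S) (allFun n))
  G = length (allFun n)
  K = 2 ^ s * q ^ M * y ^ h
  K≢0 : NonZero K
  K≢0 = m*n≢0 _ _ {{m*n≢0 _ _ {{m^n≢0 2 s}} {{m^n≢0 q M}}}}
    {{m^n≢0 y h {{m*n≢0 (2 * 2) _ {{_}} {{m*n≢0 q (suc q)}}}}}}
  gain : 2 ^ s * 2 ^ s * q ^ M ≤ suc q ^ M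
  gain = begin
    2 ^ s * 2 ^ s * q ^ M                 ≡⟨ cong₂ _*_ (trans (sym (^-distribˡ-+-* 2 s s)) (cong (2 ^_) (lem s))) (sym (^-*-assoc q q (2 * s))) ⟩
    2 ^ (2 * s) * (q ^ q) ^ (2 * s)       ≡⟨ ^-distribʳ-* 2 (q ^ q) (2 * s) ⟨
    (2 * q ^ q) ^ (2 * s)                 ≤⟨ ^-monoˡ-≤ (2 * s) (doubles q) ⟩
    (suc q ^ q) ^ (2 * s)                 ≡⟨ ^-*-assoc (suc q) q (2 * s) ⟩
    suc q ^ M ∎
    where
    lem : ∀ s → s + s ≡ 2 * s
    lem = solve-∀
  loss : suc y ^ h ≤ 2 ^ s * y ^ h
  loss = begin
    suc y ^ h                             ≡⟨ ^-*-assoc (suc y) (2 * q * q) s ⟨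
    (suc y ^ (2 * q * q)) ^ s             ≤⟨ ^-monoˡ-≤ s (at-most-doubles y (2 * q * q) small) ⟩
    (2 * y ^ (2 * q * q)) ^ s             ≡⟨ ^-distribʳ-* 2 _ s ⟩
    2 ^ s * (y ^ (2 * q * q)) ^ s         ≡⟨ cong (2 ^ s *_) (^-*-assoc y (2 * q * q) s) ⟩
    2 ^ s * y ^ h ∎
    where
    small : 2 * (2 * q * q) ≤ suc y
    small = ≤-trans (m≤m+n _ (4 * q + 1)) (≤-reflexive (lem q))
      where
      lem : ∀ q → 2 * (2 * q * q) + (4 * q + 1) ≡ suc (2 * 2 * (q * suc q))
      lem = solve-∀
  y^h : y ^ h ≡ 2 ^ h * 2 ^ h * (q ^ h * suc q ^ h)
  y^h = trans (^-distribʳ-* (2 * 2) (q * suc q) h) (cong₂ _*_ (^-distribʳ-* 2 2 h) (^-distribʳ-* q (suc q) h))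
  odd^ : suc (q + q) ^ length S ≡ suc y ^ h
  odd^ = trans (cong (suc (q + q) ^_) |S|) (trans (^-distribˡ-+-* (suc (q + q)) h h)
    (trans (sym (^-distribʳ-* (suc (q + q)) (suc (q + q)) h)) (cong (_^ h) (lem q))))
    where
    lem : ∀ q → suc (q + q) * suc (q + q) ≡ suc (2 * 2 * (q * suc q))
    lem = solve-∀
  lem₁ : ∀ a b c x → a * b * c * (x * a) ≡ x * (a * a * b * c)
  lem₁ = solve-∀
  lem₂ : ∀ x a b c d e → x * (a * (b * b * ((c * d) * e))) ≡ c * (x * ((e * a) * d) * (b * b))
  lem₂ = solve-∀
  lem₃ : ∀ a b c g → a * (b * c * g) ≡ b * a * c * g
  lem₃ = solve-∀

-- Balanced functions and choice of parameters

ind-yes : ∀ {P : Set} (P? : Dec P) → P → ind P? ≡ 1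
ind-yes (yes _) p = refl
ind-yes (no ¬p) p = ⊥-elim (¬p p)

ind-no : ∀ {P : Set} (P? : Dec P) → ¬ P → ind P? ≡ 0
ind-no (yes p) ¬p = ⊥-elim (¬p p)
ind-no (no _) ¬p = refl

∑-downFrom-≥ : ∀ J k (F : ℕ → ℕ) → J ≤ k → ∑ (downFrom J) (λ j → ind (k ℕ.≟ j) * F j) ≡ 0
∑-downFrom-≥ zero k F J≤k = refl
∑-downFrom-≥ (suc J) k F J<k =
  cong₂ (λ i r → i * F J + r) (ind-no (k ℕ.≟ J) (λ k≡J → <⇒≢ J<k (sym k≡J))) (∑-downFrom-≥ J k F (<⇒≤ J<k))

∑-downFrom-< : ∀ J k (F : ℕ → ℕ) → k < J → ∑ (downFrom J) (λ j → ind (k ℕ.≟ j) * F j) ≡ F k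
∑-downFrom-< (suc J) k F (s≤s k≤J) = at (k ℕ.≟ J)
  where
  at : Dec (k ≡ J) → ∑ (downFrom (suc J)) (λ j → ind (k ℕ.≟ j) * F j) ≡ F k
  at (yes refl) = trans (cong₂ (λ i r → i * F k + r) (ind-yes (k ℕ.≟ k) refl) (∑-downFrom-≥ k k F ≤-refl))
    (trans (+-identityʳ _) (+-identityʳ (F k)))
  at (no k≢J) = cong₂ (λ i r → i * F J + r) (ind-no (k ℕ.≟ J) k≢J) (∑-downFrom-< J k F (≤∧≢⇒< k≤J k≢J))

2ab≤a²+b² : ∀ a b → 2 * (a * b) ≤ a * a + b * b
2ab≤a²+b² zero b = z≤n
2ab≤a²+b² (suc a) zero = ≤-trans (≤-reflexive (cong (2 *_) (*-zeroʳ (suc a)))) z≤n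
2ab≤a²+b² (suc a) (suc b) = subst₂ _≤_ (lem₁ a b) (lem₂ a b) (+-monoˡ-≤ (2 * (1 + a + b)) (2ab≤a²+b² a b))
  where
  lem₁ : ∀ a b → 2 * (a * b) + 2 * (1 + a + b) ≡ 2 * (suc a * suc b)
  lem₁ = solve-∀
  lem₂ : ∀ a b → a * a + b * b + 2 * (1 + a + b) ≡ suc a * suc a + suc b * suc b
  lem₂ = solve-∀

cauchy-schwarz : ∀ {X : Set} (xs : List X) (F : X → ℕ) → ∑ xs F * ∑ xs F ≤ length xs * ∑ xs (λ x → F x * F x)
cauchy-schwarz [] F = z≤n
cauchy-schwarz (x ∷ xs) F = begin
  (a + s) * (a + s)                       ≡⟨ lem a s ⟩
  a * a + 2 * (a * s) + s * s             ≤⟨ +-mono-≤ (+-monoʳ-≤ (a * a) (cross xs)) (cauchy-schwarz xs F) ⟩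
  a * a + (m * (a * a) + Q) + m * Q       ≡⟨ lem′ (a * a) m Q ⟩
  suc m * (a * a + Q) ∎
  where
  open ≤-Reasoning
  a = F x
  s = ∑ xs F
  m = length xs
  Q = ∑ xs (λ x → F x * F x)
  cross : ∀ ys → 2 * (a * ∑ ys F) ≤ length ys * (a * a) + ∑ ys (λ y → F y * F y)
  cross ys = begin
    2 * (a * ∑ ys F)                      ≡⟨ cong (2 *_) (∑-*ˡ ys a F) ⟨
    2 * ∑ ys (λ y → a * F y)              ≡⟨ ∑-*ˡ ys 2 (λ y → a * F y) ⟨
    ∑ ys (λ y → 2 * (a * F y))            ≤⟨ ∑-mono ys (λ y → 2ab≤a²+b² a (F y)) ⟩
    ∑ ys (λ y → a * a + F y * F y)        ≡⟨ ∑-+ ys (λ _ → a * a) (λ y → F y * F y) ⟩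
    ∑ ys (λ _ → a * a) + ∑ ys (λ y → F y * F y) ≡⟨ cong (_+ ∑ ys (λ y → F y * F y)) (∑-const ys (a * a)) ⟩
    length ys * (a * a) + ∑ ys (λ y → F y * F y) ∎
  lem : ∀ a s → (a + s) * (a + s) ≡ a * a + 2 * (a * s) + s * s
  lem = solve-∀
  lem′ : ∀ a m q → a + (m * a + q) + m * q ≡ suc m * (a + q)
  lem′ = solve-∀

-- With `N j` the size of the class of key `j`, the sizes add up to `length xs` and their squares to
-- the number of colliding pairs; Cauchy-Schwarz compares the two sums over `J` classes.
collisions : ∀ {X : Set} (xs : List X) (key : X → ℕ) J → (∀ x → key x < J) →
  length xs * length xs ≤ J * ∑ xs (λ x → ∑ xs (λ y → ind (key y ℕ.≟ key x)))
collisions xs key J key< = begin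
  length xs * length xs
    ≡⟨ cong₂ _*_ size size ⟩
  ∑ (downFrom J) N * ∑ (downFrom J) N
    ≤⟨ cauchy-schwarz (downFrom J) N ⟩
  length (downFrom J) * ∑ (downFrom J) (λ j → N j * N j)
    ≡⟨ cong₂ _*_ (length-downFrom J) squares ⟩
  J * ∑ xs (λ x → N (key x)) ∎
  where
  open ≤-Reasoning
  N : ℕ → ℕ
  N j = ∑ xs (λ y → ind (key y ℕ.≟ j))
  by-key : ∀ F → ∑ xs (F ∘ key) ≡ ∑ (downFrom J) (λ j → N j * F j)
  by-key F = trans (∑-cong xs (λ x → sym (∑-downFrom-< J (key x) F (key< x))))
    (trans (∑-swap xs (downFrom J) (λ x j → ind (key x ℕ.≟ j) * F j))
      (∑-cong (downFrom J) (λ j → ∑-*ʳ xs (F j) (λ x → ind (key x ℕ.≟ j)))))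
  size : length xs ≡ ∑ (downFrom J) N
  size = trans (sym (*-identityʳ _)) (trans (sym (∑-const xs 1))
    (trans (by-key (λ _ → 1)) (∑-cong (downFrom J) (λ j → *-identityʳ (N j)))))
  squares : ∑ (downFrom J) (λ j → N j * N j) ≡ ∑ xs (λ x → N (key x))
  squares = sym (by-key N)

count-cong : ∀ {X : Set} {f g : X → Bool} b xs → (∀ x → f x ≡ g x) → count f b xs ≡ count g b xs
count-cong {f = f} {g} b xs f≡g = trans (length-filter≡∑ (λ x → f x ≟ b) xs)
  (trans (∑-cong xs (λ x → cong (λ c → ind (c ≟ b)) (f≡g x))) (sym (length-filter≡∑ (λ x → g x ≟ b) xs)))

count-map : ∀ {X Y : Set} (f : Y → Bool) (k : X → Y) b xs → count f b (map k xs) ≡ count (f ∘ k) b xs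
count-map f k b xs = trans (length-filter≡∑ (λ x → f x ≟ b) (map k xs))
  (trans (∑-map k xs _) (sym (length-filter≡∑ (λ x → f (k x) ≟ b) xs)))

countVal-halves : ∀ {n} (f : Cube (suc n) → Bool) {h g : Cube n → Bool} →
  (∀ x → f (false ∷ x) ≡ h x) → (∀ x → f (true ∷ x) ≡ g x) → ∀ b → countVal f b ≡ countVal h b + countVal g b
countVal-halves {n} f f≡h f≡g b =
  trans (cong length (filter-++ (λ x → f x ≟ b) (map (false ∷_) (allCube n)) _))
  (trans (length-++ (filter (λ x → f x ≟ b) (map (false ∷_) (allCube n))))
    (cong₂ _+_ (trans (count-map f (false ∷_) b (allCube n)) (count-cong b (allCube n) f≡h))
               (trans (count-map f (true ∷_) b (allCube n)) (count-cong b (allCube n) f≡g))))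

-- The symmetry behind this is `f ↦ not ∘ f`, but the complement of a listed function is listed only
-- up to pointwise equality. Inducting on the two halves, with `F` shifted by the count of the other
-- half, avoids comparing functions.
∑-allFun-complement : ∀ n (F : ℕ → ℕ) →
  ∑ (allFun n) (λ f → F (countVal f true)) ≡ ∑ (allFun n) (λ f → F (countVal f false))
∑-allFun-complement zero F = lem (F 0) (F 1)
  where
  lem : ∀ a b → a + (b + 0) ≡ b + (a + 0)
  lem = solve-∀
∑-allFun-complement (suc n) F with allFun-suc n
... | glue , ∑-glue , glue-false , glue-true = begin
  ∑ (allFun (suc n)) (λ f → F (countVal f true))
    ≡⟨ expand true ⟩
  ∑ (allFun n) (λ h → ∑ (allFun n) (λ g → F (countVal h true + countVal g true)))
    ≡⟨ ∑-cong (allFun n) (λ h → ∑-allFun-complement n (λ j → F (countVal h true + j))) ⟩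
  ∑ (allFun n) (λ h → ∑ (allFun n) (λ g → F (countVal h true + countVal g false)))
    ≡⟨ ∑-allFun-complement n (λ i → ∑ (allFun n) (λ g → F (i + countVal g false))) ⟩
  ∑ (allFun n) (λ h → ∑ (allFun n) (λ g → F (countVal h false + countVal g false)))
    ≡⟨ expand false ⟨
  ∑ (allFun (suc n)) (λ f → F (countVal f false)) ∎
  where
  open ≡-Reasoning
  expand : ∀ b → ∑ (allFun (suc n)) (λ f → F (countVal f b)) ≡
    ∑ (allFun n) (λ h → ∑ (allFun n) (λ g → F (countVal h b + countVal g b)))
  expand b = trans (∑-glue _) (∑-cong (allFun n) (λ h → ∑-cong (allFun n) (λ g →
    cong F (countVal-halves (glue h g) (glue-false h g) (glue-true h g) b))))

ind-mono : ∀ {P Q : Set} (P? : Dec P) (Q? : Dec Q) → (P → Q) → ind P? ≤ ind Q?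
ind-mono (no _) Q? P⇒Q = z≤n
ind-mono (yes p) (yes _) P⇒Q = ≤-refl
ind-mono (yes p) (no ¬q) P⇒Q = ⊥-elim (¬q (P⇒Q p))

-- f = (h, g) is balanced iff #h⁻¹(1) = #g⁻¹(0). By complementation such pairs are as frequent as pairs with
-- #h⁻¹(0) = #g⁻¹(0), that is, as collisions of a quantity with 2ⁿ + 1 possible values.
balanced-abundant : ∀ n → length (allFun (suc n)) ≤ suc (2 ^ n) * length (balancedFuns (suc n))
balanced-abundant n with allFun-suc n
... | glue , ∑-glue , glue-false , glue-true = begin
  length (allFun (suc n))
    ≡⟨ trans (sym (*-identityʳ _)) (trans (sym (∑-const (allFun (suc n)) 1)) (trans (∑-glue (λ _ → 1))
         (trans (∑-cong (allFun n) (λ _ → trans (∑-const (allFun n) 1) (*-identityʳ _))) (∑-const (allFun n) _)))) ⟩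
  length (allFun n) * length (allFun n)
    ≤⟨ collisions (allFun n) (λ f → countVal f false) (suc (2 ^ n)) (λ f → s≤s (bound f)) ⟩
  suc (2 ^ n) * ∑ (allFun n) (λ h → ∑ (allFun n) (λ g → ind (countVal g false ℕ.≟ countVal h false)))
    ≡⟨ cong (suc (2 ^ n) *_) (∑-allFun-complement n (λ i → ∑ (allFun n) (λ g → ind (countVal g false ℕ.≟ i)))) ⟨
  suc (2 ^ n) * ∑ (allFun n) (λ h → ∑ (allFun n) (λ g → ind (countVal g false ℕ.≟ countVal h true)))
    ≤⟨ *-monoʳ-≤ (suc (2 ^ n)) (∑-mono (allFun n) (λ h → ∑-mono (allFun n) (λ g →
         ind-mono (countVal g false ℕ.≟ countVal h true) (balanced? (glue h g)) (balance h g)))) ⟩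
  suc (2 ^ n) * ∑ (allFun n) (λ h → ∑ (allFun n) (λ g → ind (balanced? (glue h g))))
    ≡⟨ cong (suc (2 ^ n) *_) (trans (sym (∑-glue (λ f → ind (balanced? f)))) (sym (length-filter≡∑ balanced? (allFun (suc n))))) ⟩
  suc (2 ^ n) * length (balancedFuns (suc n)) ∎
  where
  open ≤-Reasoning
  both : ∀ f → countVal f false + countVal f true ≡ 2 ^ n
  both f = trans (count-false-true f (allCube n)) (length-allCube n)
  bound : ∀ f → countVal f false ≤ 2 ^ n
  bound f = ≤-trans (m≤m+n _ _) (≤-reflexive (both f))
  balance : ∀ h g → countVal g false ≡ countVal h true → Balanced (glue h g)
  balance h g eq = trans (split false) (trans (cong₂ _+_ h₀≡g₁ eq) (trans (+-comm (countVal g true) _) (sym (split true))))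
    where
    split : ∀ b → countVal (glue h g) b ≡ countVal h b + countVal g b
    split = countVal-halves (glue h g) (glue-false h g) (glue-true h g)
    h₀≡g₁ : countVal h false ≡ countVal g true
    h₀≡g₁ = +-cancelʳ-≡ (countVal h true) _ _
      (trans (both h) (trans (sym (both g)) (trans (+-comm (countVal g false) _) (cong (countVal g true +_) eq))))

length-filter-¬ : ∀ {X : Set} {P : X → Set} (P? : Decidable P) xs →
  length xs ≡ length (filter P? xs) + length (filter (λ x → ¬? (P? x)) xs)
length-filter-¬ P? [] = refl
length-filter-¬ P? (x ∷ xs) with P? x
... | yes _ = cong suc (length-filter-¬ P? xs)
... | no _ = trans (cong suc (length-filter-¬ P? xs)) (sym (+-suc _ _))

-- Most balanced functions fill every slab evenly.

module _ {n d e α} (B : Blocks n d e α) (q s : ℕ) .{{_ : NonZero q}} where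
  open Blocks B

  halfSlab slack : ℕ
  halfSlab = 2 * q * q * s
  slack = q * (2 * s)

  -- The events "too many values b in a slab" are indexed by (c ∷ b ∷ v).
  Excess : Cube (2 + d) → (Cube (suc n) → Bool) → Set
  Excess y f = halfSlab + slack ≤ count f (head (tail y)) (slab B (head y) (tail (tail y)))

  excess? : ∀ y → Decidable (Excess y)
  excess? y f = halfSlab + slack ≤? count f (head (tail y)) (slab B (head y) (tail (tail y)))

  Tame : (Cube (suc n) → Bool) → Set
  Tame f = All (λ y → ¬ Excess y f) (allCube (2 + d))

  tame? : Decidable Tame
  tame? f = All.all? (λ y → ¬? (excess? y f)) (allCube (2 + d))

  slab-unique : ∀ c v → Unique (slab B c v)
  slab-unique c v = Unique.map⁺ ∷-injectiveʳ (Unique.map⁺ (proj₂ ∘ point-injective B) (allCube-unique e))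

  wild-rare : 2 ^ e ≡ halfSlab + halfSlab → slack ≤ halfSlab →
    length (filter (λ f → ¬? (tame? f)) (allFun (suc n))) * 2 ^ s ≤ 2 ^ (2 + d) * length (allFun (suc n))
  wild-rare 2^e slack≤alfSlab = begin
    length (filter (λ f → ¬? (tame? f)) (allFun (suc n))) * 2 ^ s
      ≤⟨ *-monoˡ-≤ (2 ^ s) (union-bound excess? (allFun (suc n)) (allCube (2 + d))) ⟩
    ∑ (allCube (2 + d)) (λ y → length (filter (excess? y) (allFun (suc n)))) * 2 ^ s
      ≡⟨ ∑-*ʳ (allCube (2 + d)) (2 ^ s) (λ y → length (filter (excess? y) (allFun (suc n)))) ⟨
    ∑ (allCube (2 + d)) (λ y → length (filter (excess? y) (allFun (suc n))) * 2 ^ s)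
      ≤⟨ ∑-mono (allCube (2 + d)) (λ y → tail-bound (slab B (head y) (tail (tail y))) (slab-unique _ _) (head (tail y))
           q s (halfSlab ∸ slack) (trans (length-slab B _ _) 2^e) (m+[n∸m]≡n slack≤alfSlab)) ⟩
    ∑ (allCube (2 + d)) (λ y → length (allFun (suc n)))
      ≡⟨ trans (∑-const (allCube (2 + d)) _) (cong (_* length (allFun (suc n))) (length-allCube (2 + d))) ⟩
    2 ^ (2 + d) * length (allFun (suc n)) ∎
    where open ≤-Reasoning

  -- The exponent `3 * n + 3` is a budget: `n` for `suc k ≤ 2 ^ n`, `2 + n` for the number of events
  -- in the union bound, and `n + 1` for passing from all functions to balanced ones.
  mostly-Good : ∀ k → 2 ^ e ≡ halfSlab + halfSlab → capacity d (4 * slack) + slack ≤ halfSlab → k < 2 ^ n → 3 * n + 3 ≤ s →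
    Σ (List (Cube (suc n) → Bool)) λ L → (L ⊆ balancedFuns (suc n)) × All (Good (suc (α + (3 + α)))) L ×
      (length (balancedFuns (suc n)) * k ≤ length L * suc k)
  mostly-Good k 2^e cap≤ k<2^n s≥ = L , filter-⊆ tame? bal , All.tabulate good , enough
    where
    open ≤-Reasoning
    bal = balancedFuns (suc n)
    L = filter tame? bal
    wild = length (filter (λ f → ¬? (tame? f)) bal)
    good : ∀ {f} → f ∈ L → Good (suc (α + (3 + α))) f
    good {f} f∈ with ∈-filter⁻ tame? {xs = bal} f∈
    ... | f∈bal , tame = tame⇒Good B 2^e cap≤ f (proj₂ (∈-filter⁻ balanced? {xs = allFun (suc n)} f∈bal))
      (λ v c b → <⇒≤ (≰⇒> (All.lookup tame (∈-allCube (c ∷ b ∷ v)))))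
    wild-few : wild * suc k ≤ length bal
    wild-few = *-cancelʳ-≤ _ _ (2 ^ s) {{m^n≢0 2 s}} (begin
      wild * suc k * 2 ^ s
        ≡⟨ lem₁ wild (suc k) (2 ^ s) ⟩
      suc k * (wild * 2 ^ s)
        ≤⟨ *-mono-≤ k<2^n (*-monoˡ-≤ (2 ^ s) (length-mono-≤
             (filter⁺ (λ f → ¬? (tame? f)) (λ f → ¬? (tame? f)) (λ { refl p → p }) (filter-⊆ balanced? (allFun (suc n)))))) ⟩
      2 ^ n * (length (filter (λ f → ¬? (tame? f)) (allFun (suc n))) * 2 ^ s)
        ≤⟨ *-monoʳ-≤ (2 ^ n) (wild-rare 2^e (≤-trans (m≤n+m slack _) cap≤)) ⟩
      2 ^ n * (2 ^ (2 + d) * length (allFun (suc n)))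
        ≤⟨ *-monoʳ-≤ (2 ^ n) (*-mono-≤ (^-monoʳ-≤ 2 (+-monoʳ-≤ 2 d≤n)) (≤-trans (balanced-abundant n)
             (*-monoˡ-≤ (length bal) (+-monoˡ-≤ (2 ^ n) (m^n>0 2 n))))) ⟩
      2 ^ n * (2 ^ (2 + n) * ((2 ^ n + 2 ^ n) * length bal))
        ≡⟨ lem₂ (2 ^ n) (length bal) ⟩
      length bal * (2 ^ n * (2 ^ n * 2 ^ n) * 8)
        ≡⟨ cong (length bal *_) (trans (cong (_* 8) (trans (cong (2 ^ n *_) (sym (^-distribˡ-+-* 2 n n)))
             (sym (^-distribˡ-+-* 2 n (n + n))))) (sym (^-distribˡ-+-* 2 (n + (n + n)) 3))) ⟩
      length bal * 2 ^ (n + (n + n) + 3)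
        ≤⟨ *-monoʳ-≤ (length bal) (^-monoʳ-≤ 2 (≤-trans (≤-reflexive (lem₃ n)) s≥)) ⟩
      length bal * 2 ^ s ∎)
      where
      lem₁ : ∀ a b c → a * b * c ≡ b * (a * c)
      lem₁ = solve-∀
      lem₂ : ∀ x y → x * (2 * (2 * x) * ((x + x) * y)) ≡ y * (x * (x * x) * 8)
      lem₂ = solve-∀
      lem₃ : ∀ n → n + (n + n) + 3 ≡ 3 * n + 3
      lem₃ = solve-∀
    enough : length bal * k ≤ length L * suc k
    enough = +-cancelʳ-≤ (length bal) _ _ (begin
      length bal * k + length bal                 ≡⟨ trans (+-comm _ (length bal)) (sym (*-suc (length bal) k)) ⟩
      length bal * suc k                          ≡⟨ cong (_* suc k) (length-filter-¬ tame? bal) ⟩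
      (length L + wild) * suc k                   ≡⟨ *-distribʳ-+ (suc k) (length L) wild ⟩
      length L * suc k + wild * suc k             ≤⟨ +-monoʳ-≤ (length L * suc k) wild-few ⟩
      length L * suc k + length bal ∎)

  capacity-suffices : 9 * n + 1 ≤ q → 3 * n + 3 ≤ s → capacity d (4 * slack) + slack ≤ halfSlab
  capacity-suffices q≥ s≥ = begin
    capacity d (4 * slack) + slack
      ≤⟨ +-monoˡ-≤ slack (≤-trans (capacity-bound d (4 * slack)) (*-mono-≤ d≤n (*-monoʳ-≤ 2 (+-monoʳ-≤ (4 * slack) d≤n)))) ⟩
    n * (2 * (4 * slack + n)) + slack
      ≡⟨ lem₁ n q s ⟩
    n * (16 * (q * s) + 2 * n) + 2 * (q * s)
      ≤⟨ +-monoˡ-≤ (2 * (q * s)) (*-monoʳ-≤ n (+-monoʳ-≤ (16 * (q * s)) 2n≤qs)) ⟩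
    n * (16 * (q * s) + q * s) + 2 * (q * s)
      -- Rounds 17 up to 18, so that the total becomes twice `9 * n + 1`, matching the factor 2 in
      -- `halfSlab`.
      ≤⟨ m≤m+n _ (n * (q * s)) ⟩
    n * (16 * (q * s) + q * s) + 2 * (q * s) + n * (q * s)
      ≡⟨ lem₂ n (q * s) ⟩
    2 * (9 * n + 1) * (q * s)
      ≤⟨ *-monoˡ-≤ (q * s) (*-monoʳ-≤ 2 q≥) ⟩
    2 * q * (q * s)
      ≡⟨ *-assoc (2 * q) q s ⟨
    halfSlab ∎
    where
    open ≤-Reasoning
    2n≤qs : 2 * n ≤ q * s
    2n≤qs = ≤-trans (≤-trans (≤-trans (m≤m+n (2 * n) (n + 3)) (≤-reflexive (lem n))) s≥) (m≤n*m s q)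
      where
      lem : ∀ n → 2 * n + (n + 3) ≡ 3 * n + 3
      lem = solve-∀
    lem₁ : ∀ n q s → n * (2 * (4 * (q * (2 * s)) + n)) + q * (2 * s) ≡ n * (16 * (q * s) + 2 * n) + 2 * (q * s)
    lem₁ = solve-∀
    lem₂ : ∀ n x → n * (16 * x + x) + 2 * x + n * x ≡ 2 * (9 * n + 1) * x
    lem₂ = solve-∀

-- Choice of the scale.

n<2^n : ∀ n → n < 2 ^ n
n<2^n zero = s≤s z≤n
n<2^n (suc n) = ≤-trans (+-mono-≤ (m^n>0 2 n) (n<2^n n)) (≤-reflexive (cong (2 ^ n +_) (sym (+-identityʳ _))))

-- A logarithm by induction: the exponent moves up exactly when the upper bound is reached. Writing
-- the number as `m + c` makes exponent 0 valid at the start.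
dyadic-scale : ∀ c .{{_ : NonZero c}} m → Σ ℕ λ t → c * 2 ^ t ≤ m + c × m + c < c * 2 ^ suc t
dyadic-scale c zero = 0 , ≤-reflexive (*-identityʳ c) , m<m*n c 2 (s≤s (s≤s z≤n))
dyadic-scale c (suc m) with dyadic-scale c m
... | t , lower , upper with suc (m + c) <? c * 2 ^ suc t
... | yes upper′ = t , m≤n⇒m≤1+n lower , upper′
... | no ¬upper′ = suc t , ≮⇒≥ ¬upper′ ,
  <-≤-trans (s≤s upper) (*-monoʳ-< c (^-monoʳ-< 2 (s≤s (s≤s z≤n)) (n<1+n (suc t))))

-- The sum of the four `r` is left in the shape to which `4 * r` reduces; its final 0 is the label
-- length of the `m` spare coordinates.
four-Hamming : ∀ r m → let ℓ = hammingLength r in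
  Σ ℕ λ d → Blocks (ℓ + (ℓ + (ℓ + (ℓ + m)))) d (r + (r + (r + (r + 0)))) 4
four-Hamming r m = _ , hamming r ⊗ (hamming r ⊗ (hamming r ⊗ (hamming r ⊗ trivial m)))

blocks-at : ∀ n r → 4 * 2 ^ r ≤ n → Σ ℕ λ d → Blocks n d (r + (r + (r + (r + 0)))) 4
blocks-at n r 4*2^r≤n with m≤n⇒∃[o]m+o≡n 4ℓ≤n
  where
  4ℓ≤n : 4 * hammingLength r ≤ n
  4ℓ≤n = ≤-trans (*-monoʳ-≤ 4 (≤-trans (n≤1+n _) (≤-reflexive (hammingLength-2^ r)))) 4*2^r≤n
... | m , refl = subst (λ k → Σ ℕ λ d → Blocks k d (r + (r + (r + (r + 0)))) 4) (lem (hammingLength r) m) (four-Hamming r m)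
  where
  lem : ∀ ℓ m → ℓ + (ℓ + (ℓ + (ℓ + m))) ≡ 4 * ℓ + m
  lem = solve-∀

module _ (n r b σ : ℕ) .{{_ : NonZero b}} .{{_ : NonZero σ}} where

  -- Here `b` is a constant and `σ` grows linearly with `n`. The block size `(2bσ)⁴` must equal
  -- `4q²s`; giving `q` one power of `σ` and a large constant, `q = 2b²σ`, leaves `s = σ²`. Then
  -- `b ≥ 72` yields `q ≥ 9n + 1`, and `σ ≥ 48b` yields `s ≥ 3n + 3`.
  at-scale : ∀ k → k ≤ n → 2 ^ r ≡ 2 * b * σ → 8 * b * σ ≤ n → n < 16 * b * σ → 72 ≤ b → 48 * b ≤ σ →
    Σ (List (Cube (suc n) → Bool)) λ L → (L ⊆ balancedFuns (suc n)) × All (Good 12) L ×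
      (length (balancedFuns (suc n)) * k ≤ length L * suc k)
  at-scale k k≤n 2^r n≥ n< b≥ σ≥ with blocks-at n r (≤-trans (≤-reflexive (trans (cong (4 *_) 2^r) (lem b σ))) n≥)
    where
    lem : ∀ b σ → 4 * (2 * b * σ) ≡ 8 * b * σ
    lem = solve-∀
  ... | d , B = mostly-Good B q s k 2^e (capacity-suffices B q s q≥ s≥) (≤-<-trans k≤n (n<2^n n)) s≥
    where
    open ≤-Reasoning
    q = 2 * b * (b * σ)
    s = σ * σ
    instance
      q≢0 : NonZero q
      q≢0 = m*n≢0 (2 * b) (b * σ) {{m*n≢0 2 b}} {{m*n≢0 b σ}}
    q≥ : 9 * n + 1 ≤ q
    q≥ = begin
      9 * n + 1            ≤⟨ m≤m+n _ 8 ⟩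
      9 * n + 1 + 8        ≡⟨ lem n ⟩
      9 * suc n            ≤⟨ *-monoʳ-≤ 9 n< ⟩
      9 * (16 * b * σ)     ≡⟨ lem′ b σ ⟩
      2 * 72 * (b * σ)     ≤⟨ *-monoˡ-≤ (b * σ) (*-monoʳ-≤ 2 b≥) ⟩
      2 * b * (b * σ) ∎
      where
      lem : ∀ n → 9 * n + 1 + 8 ≡ 9 * suc n
      lem = solve-∀
      lem′ : ∀ b σ → 9 * (16 * b * σ) ≡ 2 * 72 * (b * σ)
      lem′ = solve-∀
    s≥ : 3 * n + 3 ≤ s
    s≥ = begin
      3 * n + 3            ≡⟨ lem n ⟩
      3 * suc n            ≤⟨ *-monoʳ-≤ 3 n< ⟩
      3 * (16 * b * σ)     ≡⟨ lem′ b σ ⟩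
      48 * b * σ           ≤⟨ *-monoˡ-≤ σ σ≥ ⟩
      σ * σ ∎
      where
      lem : ∀ n → 3 * n + 3 ≡ 3 * suc n
      lem = solve-∀
      lem′ : ∀ b σ → 3 * (16 * b * σ) ≡ 48 * b * σ
      lem′ = solve-∀
    2^e : 2 ^ (r + (r + (r + (r + 0)))) ≡ 2 * q * q * s + 2 * q * q * s
    2^e = begin-equality
      2 ^ (4 * r)                         ≡⟨ cong (2 ^_) (*-comm 4 r) ⟩
      2 ^ (r * 4)                         ≡⟨ ^-*-assoc 2 r 4 ⟨
      (2 ^ r) ^ 4                         ≡⟨ cong (_^ 4) 2^r ⟩
      (2 * b * σ) ^ 4                     ≡⟨ lem b σ ⟩
      2 * q * q * s + 2 * q * q * s ∎
      where
      lem : ∀ b σ → let x = 2 * b * σ; q = 2 * b * (b * σ) in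
        x * (x * (x * (x * 1))) ≡ 2 * q * q * (σ * σ) + 2 * q * q * (σ * σ)
      lem = solve-∀

eventually : ∀ b .{{_ : NonZero b}} a → 2 ^ a ≡ 2 * b → 72 ≤ b → ∀ k n → k + 16 * b * (48 * b) ≤ n →
  Σ (List (Cube (suc n) → Bool)) λ L → (L ⊆ balancedFuns (suc n)) × All (Good 12) L ×
    (length (balancedFuns (suc n)) * k ≤ length L * suc k)
eventually b a 2^a b≥ k n n≥ with dyadic-scale (8 * b) {{m*n≢0 8 b}} (n ∸ 8 * b)
... | t , lower , upper =
  at-scale n (a + t) b (2 ^ t) {{it}} {{m^n≢0 2 t}} k (≤-trans (m≤m+n k _) n≥)
    (trans (^-distribˡ-+-* 2 a t) (cong (_* 2 ^ t) 2^a))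
    (≤-trans lower (≤-reflexive n≡)) n<
    -- The lower bound on `n` and `n < 16 * b * 2 ^ t` together force `48 * b ≤ 2 ^ t`.
    b≥ (*-cancelˡ-≤ (16 * b) {{m*n≢0 16 b}} (≤-trans (m≤n+m _ k) (≤-trans n≥ (<⇒≤ n<))))
  where
  8b≤ : 8 * b ≤ 16 * b * (48 * b)
  8b≤ = ≤-trans (*-monoˡ-≤ b (m≤m+n 8 8)) (m≤m*n (16 * b) (48 * b) {{m*n≢0 48 b}})
  n≡ : n ∸ 8 * b + 8 * b ≡ n
  n≡ = m∸n+n≡m (≤-trans 8b≤ (≤-trans (m≤n+m _ k) n≥))
  n< : n < 16 * b * 2 ^ t
  n< = ≤-trans (≤-reflexive (cong suc (sym n≡))) (≤-trans upper (≤-reflexive (lem b (2 ^ t))))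
    where
    lem : ∀ b x → 8 * b * (2 * x) ≡ 16 * b * x
    lem = solve-∀

theorem1p4 : Σ ℕ λ C → (k : ℕ) → Σ ℕ λ N → (n : ℕ) → N ≤ n →
    Σ (List (Cube (suc n) → Bool)) λ L →
    (L ⊆ balancedFuns (suc n)) × All (Good C) L ×
    (length (balancedFuns (suc n)) * k ≤ length L * suc k)
-- 128 is the least power of two that is at least 72, and 8 is the exponent of `2 * 128`.
theorem1p4 = 12 , λ k → k + 16 * 128 * (48 * 128) , eventually 128 8 refl (m≤m+n 72 56) k
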